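{- Consider a simple graph stream processed by FURL-S and by FURL-SX with buffer size $M$, bucket size $J>0$ and decaying factor $0\le\delta<1$. Let $\lambda$ be a triangle with $T_\lambda>M+1$, and let $X_\lambda$ and $Y_\lambda$ be the estimated counts of $\lambda$ by FURL-S and by FURL-SX, respectively. Let $\mu_Y=\mathbb{E}[Y_\lambda]$, $\sigma_Y^2=\operatorname{Var}[Y_\lambda]$, $\mu_X=\mathbb{E}[X_\lambda]=1$, $\sigma_X^2=\operatorname{Var}[X_\lambda]$, and $\epsilon=\mu_X-\mu_Y+\sigma_Y^2$. If $$\frac{2-\delta}{1-\delta}<q_{T_\lambda},\qquad q_{T_\lambda}=\frac{(T_\lambda-1)(T_\lambda-2)}{M(M-1)},$$ then $\Pr[|Y_\lambda-\mu_X|<\epsilon]$ has a larger lower bound based on the Chebyshev inequality than $\Pr[|X_\lambda-\mu_X|<\epsilon]$ does; that is, $$\Pr[|Y_\lambda-\mu_X|<\epsilon]\ge 1-\frac{1}{\sigma_Y^2},\qquad \Pr[|X_\lambda-\mu_X|<\epsilon]\ge 1-\frac{\sigma_X^2}{\epsilon^2},\qquad\text{and}\qquad 1-\frac1{\sigma_Y^2}>1-\frac{\sigma_X^2}{\epsilon^2}.$$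
   Context: A simple graph stream is a fixed sequence of pairwise distinct undirected edges $e_1,e_2,\dots$ without self-loops; the edge $e_T$ arrives at time $T$. A triangle $\lambda$ is formed at the time $T_\lambda$ when the last of its three edges arrives; this is the only time at which it can be counted. Probabilities, expectations and variances are over the randomness of the algorithm. FURL-S (basic algorithm). It keeps a buffer $D$ of $M$ edges filled by reservoir sampling: the edge arriving at time $T\le M$ is stored; for $T>M$ an integer $i$ is drawn uniformly from $\{1,\dots,T\}$ (independently of the past) and, if $i\le M$, the $i$-th item of $D$ is replaced by the new edge (else the new edge is discarded). Before this sampling step at time $T$, every triangle consisting of the arriving edge and two edges currently in $D$ is counted, with weight $1$ if $T\le M+1$ and weight $q_T=\frac{(T-1)(T-2)}{M(M-1)}$ if $T>M+1$; the weight is added to the estimates of its three nodes. The estimated count $X_\lambda$ of a triangle $\lambda$ by FURL-S is the weight with which $\lambda$ is counted at time $T_\lambda$, or $0$ if it is not counted. FURL-SX. Let $T_M=M+1$ (the last time at which the FURL-S estimate is guaranteed exact). Bucket $0$ is the time interval $[1,T_M]$ and, for $i\ge1$, bucket $i$ is the set of times $t$ with $T_M+(i-1)J<t\le T_M+iJ$. If $c^{(t)}$ is the FURL-S estimate at time $t$, the FURL-SX estimate is $\tau^{(t)}=c^{(t)}$ for $t$ in bucket $0$, and $\tau^{(t)}=\delta\,\tau^{(T_M+(i-1)J)}+(1-\delta)\,c^{(t)}$ for $t$ in bucket $i>0$. Correspondingly, the estimated count of a triangle $\lambda$ by FURL-SX is its contribution to $\tau$: put $x^{(t)}=X_\lambda$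 if $t\ge T_\lambda$ and $x^{(t)}=0$ if $t<T_\lambda$; let $y^{(t)}=x^{(t)}$ in bucket $0$ and $y^{(t)}=\delta\,y^{(T_M+(i-1)J)}+(1-\delta)\,x^{(t)}$ in bucket $i>0$; then $Y_\lambda=y^{(T)}$ where $T\ge T_\lambda$ is the current time.
   Formalization: The strict comparison of the two lower bounds is proved only for 0<δ<1 (for δ=0 only ≥): at δ=0, Y_λ=X_λ and both bounds equal 1-1/σ_X², so strictness fails. Reals are replaced by any totally ordered field with decidable order. -}

module Defs where

open import Algebra.Bundles using (CommutativeRing)
open import Algebra.Structures using (IsCommutativeRing)
import Algebra.Definitions.RawMonoid as RawMonoidDefs
open import Data.Bool.Base using (if_then_else_)
open import Data.Fin.Base as Fin using (Fin; toℕ; fromℕ<)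
open import Data.Fin.Properties using (toℕ<n)
open import Data.Maybe.Base using (Maybe; just; nothing)
import Data.Maybe.Relation.Unary.Any as Maybe
open import Data.Nat.Base as ℕ using (ℕ; zero; suc; NonZero; _≤′_; ≤′-reflexive; ≤′-step)
import Data.Nat.DivMod as ℕ
import Data.Nat.Properties as ℕ
open import Data.Product.Base using (_×_; _,_; proj₁; proj₂)
open import Data.Sum.Base using (_⊎_)
open import Data.Unit.Base using (⊤; tt)
open import Data.Vec.Base using (Vec; replicate; _[_]≔_)
import Data.Vec.Relation.Unary.Any as Vec
open import Level using (Level; _⊔_) renaming (suc to lsuc)
open import Relation.Binary.Core using (Rel)
open import Relation.Binary.Definitions using (Decidable; DecidableEquality)
open import Relation.Binary.PropositionalEquality using (_≡_; _≢_; refl)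
open import Relation.Binary.Structures using (IsStrictTotalOrder)
import Relation.Binary.Construct.StrictToNonStrict as StrictToNonStrict
open import Relation.Nullary using (¬_; Dec; yes; no; does)
open import Relation.Nullary.Decidable using (_×-dec_; _⊎-dec_)
import Relation.Unary as Unary

private
  variable
    v p : Level

-- Totally ordered fields stand in for the real numbers, which are
-- (classically) an instance.  The inverse is a total operation whose value
-- at 0# is left unspecified.

record OrderedField k ℓ₁ ℓ₂ : Set (lsuc (k ⊔ ℓ₁ ⊔ ℓ₂)) where
  infix  8 _⁻¹ -_
  infixl 7 _*_ _/_
  infixl 6 _+_ _-_
  infix  4 _≈_ _<_
  field
    Carrier            : Set k
    _≈_                : Rel Carrier ℓ₁
    _<_                : Rel Carrier ℓ₂
    _+_ _*_            : Carrier → Carrier → Carrier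
    -_ _⁻¹             : Carrier → Carrier
    0# 1#              : Carrier
    isCommutativeRing  : IsCommutativeRing _≈_ _+_ _*_ -_ 0# 1#
    isStrictTotalOrder : IsStrictTotalOrder _≈_ _<_
    ⁻¹-cong            : ∀ {x y} → x ≈ y → x ⁻¹ ≈ y ⁻¹
    *-inverseʳ         : ∀ x → ¬ (x ≈ 0#) → x * x ⁻¹ ≈ 1#
    0<1                : 0# < 1#
    +-monoˡ-<          : ∀ z {x y} → x < y → x + z < y + z
    *-pos              : ∀ {x y} → 0# < x → 0# < y → 0# < x * y

  commutativeRing : CommutativeRing k ℓ₁
  commutativeRing = record { isCommutativeRing = isCommutativeRing }

  open IsStrictTotalOrder isStrictTotalOrder public using (_<?_)
  open StrictToNonStrict _≈_ _<_ public using (_≤_)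
  open RawMonoidDefs (CommutativeRing.+-rawMonoid commutativeRing) public
    using (sum) renaming (_×_ to _·_)

  _-_ _/_ : Carrier → Carrier → Carrier
  x - y = x + (- y)
  x / y = x * y ⁻¹

  2# : Carrier
  2# = 1# + 1#

  fromℕ : ℕ → Carrier
  fromℕ n = n · 1#

  _² : Carrier → Carrier
  x ² = x * x

  ∣_∣ : Carrier → Carrier
  ∣ x ∣ = if does (x <? 0#) then - x else x

-- An undirected edge is a pair of nodes, taken up to _~_.

Edge : Set v → Set v
Edge V = V × V

_~_ : {V : Set v} → Rel (Edge V) v
(a , b) ~ (c , d) = (a ≡ c × b ≡ d) ⊎ (a ≡ d × b ≡ c)

-- The edge with index i arrives at time 1 + i.

record GraphStream (V : Set v) (N : ℕ) : Set v where
  field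
    edge     : Fin N → Edge V
    loopless : ∀ i → proj₁ (edge i) ≢ proj₂ (edge i)
    distinct : ∀ i j → i ≢ j → ¬ (edge i ~ edge j)

-- The nodes are named so that the edge between c and a is the last to arrive.

record Triangle {V : Set v} {N : ℕ} (S : GraphStream V N) : Set v where
  open GraphStream S
  field
    a b c    : V
    ab bc ca : Fin N
    edge-ab  : edge ab ~ (a , b)
    edge-bc  : edge bc ~ (b , c)
    edge-ca  : edge ca ~ (c , a)
    ab<ca    : ab Fin.< ca
    bc<ca    : bc Fin.< ca

  formationTime : ℕ
  formationTime = suc (toℕ ca)

-- The random draws made up to time T.  The draw i : Fin t at time t stands for
-- the integer 1 + toℕ i, uniform in {1,…,t}.  Draws at times t ≤ M are present
-- in the sample space but never used by the algorithm.

Draws : ℕ → Set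
Draws zero    = ⊤
Draws (suc t) = Draws t × Fin (suc t)

prefix : ∀ {t T} → t ≤′ T → Draws T → Draws t
prefix (≤′-reflexive refl) ω       = ω
prefix (≤′-step t≤T)       (ω , _) = prefix t≤T ω

module Probability {k ℓ₁ ℓ₂} (K : OrderedField k ℓ₁ ℓ₂) where
  open OrderedField K

  -- Expectation for independent uniform draws, as an iterated average.
  𝔼 : ∀ {T} → (Draws T → Carrier) → Carrier
  𝔼 {zero}  Z = Z tt
  𝔼 {suc T} Z = 𝔼 λ ω → sum (λ i → Z (ω , i)) / fromℕ (suc T)

  Var : ∀ {T} → (Draws T → Carrier) → Carrier
  Var Z = 𝔼 λ ω → (Z ω - 𝔼 Z) ²

  Pr : ∀ {T} {P : Unary.Pred (Draws T) p} → Unary.Decidable P → Carrier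
  Pr P? = 𝔼 λ ω → if does (P? ω) then 1# else 0#

module Reservoir {V : Set v} (_≟_ : DecidableEquality V) (M : ℕ) where

  Buffer : Set v
  Buffer = Vec (Maybe (Edge V)) M

  -- The sampling step at time 1 + n: slots are filled in order while there
  -- is room; afterwards the drawn slot, if there is one, is overwritten.
  step : ∀ n → Edge V → Fin (suc n) → Buffer → Buffer
  step n e i D with n ℕ.<? M
  ... | yes n<M = D [ fromℕ< n<M ]≔ just e
  ... | no  _ with toℕ i ℕ.<? M
  ...   | yes i<M = D [ fromℕ< i<M ]≔ just e
  ...   | no  _   = D

  module _ {N : ℕ} (S : GraphStream V N) where
    open GraphStream S

    -- The buffer after the edges with times 1,…,t have been processed.
    buffer : ∀ {t} → .(t ℕ.≤ N) → Draws t → Buffer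
    buffer {zero}  _   _       = replicate M nothing
    buffer {suc t} t<N (ω , i) =
      step t (edge (fromℕ< t<N)) i (buffer (ℕ.<⇒≤ t<N) ω)

  _∈_ : Edge V → Buffer → Set v
  e ∈ D = Vec.Any (Maybe.Any (e ~_)) D

  _~?_ : Decidable (_~_ {V = V})
  (a , b) ~? (c , d) = ((a ≟ c) ×-dec (b ≟ d)) ⊎-dec ((a ≟ d) ×-dec (b ≟ c))

  _∈?_ : Decidable _∈_
  e ∈? D = Vec.any? (Maybe.dec (e ~?_)) D

module FURL {k ℓ₁ ℓ₂} (K : OrderedField k ℓ₁ ℓ₂)
            {V : Set v} (_≟_ : DecidableEquality V)
            {N : ℕ} (S : GraphStream V N) (M : ℕ) where
  open OrderedField K
  open Reservoir _≟_ M

  q : ℕ → Carrier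
  q T = ((fromℕ T - 1#) * (fromℕ T - 2#)) / (fromℕ M * (fromℕ M - 1#))

  weight : ℕ → Carrier
  weight T = if does (T ℕ.≤? suc M) then 1# else q T

  module _ (Δ : Triangle S) where
    open Triangle Δ

    bufferAtFormation : Draws (toℕ ca) → Buffer
    bufferAtFormation = buffer S (ℕ.<⇒≤ (toℕ<n ca))

    Counted : Draws (toℕ ca) → Set _
    Counted ω = (a , b) ∈ bufferAtFormation ω × (b , c) ∈ bufferAtFormation ω

    counted? : Unary.Decidable Counted
    counted? ω = ((a , b) ∈? bufferAtFormation ω) ×-dec ((b , c) ∈? bufferAtFormation ω)

    -- The estimated count of Δ by FURL-S, on the sample space of the draws
    -- made up to the current time T.
    X : ∀ {T} → formationTime ℕ.≤ T → Draws T → Carrier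
    X Tλ≤T ω =
      if does (counted? (prefix (ℕ.≤⇒≤′ (ℕ.<⇒≤ Tλ≤T)) ω))
      then weight formationTime else 0#

  module _ (J : ℕ) .{{_ : NonZero J}} (δ : Carrier) where

    T-M : ℕ
    T-M = suc M

    bucket : ℕ → ℕ
    bucket t = if does (t ℕ.≤? T-M) then 0 else suc ((t ℕ.∸ suc T-M) ℕ./ J)

    -- smooth x i t is the smoothed value at a time t lying in bucket i; the
    -- time T-M + i * J is the last one of bucket i.
    smooth : (ℕ → Carrier) → ℕ → ℕ → Carrier
    smooth x zero    t = x t
    smooth x (suc i) t = δ * smooth x i (T-M ℕ.+ i ℕ.* J) + (1# - δ) * x t

    -- The estimated count of Δ by FURL-SX at the current time T.
    Y : (Δ : Triangle S) → ∀ {T} → Triangle.formationTime Δ ℕ.≤ T → Draws T → Carrier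
    Y Δ {T} Tλ≤T ω = smooth x (bucket T) T
      where
      x : ℕ → Carrier
      x t = if does (Triangle.formationTime Δ ℕ.≤? t) then X Δ Tλ≤T ω else 0#

{-# OPTIONS --safe #-}
-- With c the value at time T of the smoothed indicator of {t ≥ Tλ}, one has Y = c X, where
-- 1 − δ ≤ c ≤ 1, and X = q [counted].  Reservoir sampling gives Pr[counted] = 1/q, hence
-- σX² = q − 1 and σY² = c u with u = c (q − 1).  The hypothesis on q says that u > 1, so that
-- ε = 1 − c + c u exceeds 1 and both events contain {X = 0}, of probability 1 − 1/q.  The
-- bounds then follow from σY² ≤ q and ε² ≤ u² = σX² σY²; the last inequality is strict if c < 1.
--
-- For Pr[counted], let n and m be the numbers of slots holding the two edges.  Since the edges
-- differ, no slot is counted by both, so replacing a uniform slot changes the expectations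
-- of n and of n m by a constant factor.  As n, m ≤ 1, n m is the indicator of being counted.
module Submission where

open import Defs
open import Algebra.Bundles using (CommutativeRing)
import Algebra.Solver.Ring as RingSolver
open import Algebra.Solver.Ring.AlmostCommutativeRing
  using (fromCommutativeRing; _-Raw-AlmostCommutative⟶_)
open import Data.Bool.Base using (Bool; true; false; if_then_else_; _∧_)
open import Data.Fin.Base as Fin using (Fin; zero; suc; toℕ; fromℕ<)
import Data.Fin.Properties as Fin
open import Data.Integer.Base as ℤ using (ℤ; +_; -[1+_])
import Data.Integer.Properties as ℤ
open import Data.Maybe.Base using (Maybe; just; nothing)
import Data.Maybe.Relation.Unary.Any as MaybeAny
open import Data.Nat.Base as ℕ using (ℕ; zero; suc; NonZero; _≤′_; ≤′-reflexive; ≤′-step; z≤n; s≤s)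
import Data.Nat.DivMod as ℕ
import Data.Nat.Properties as ℕ
import Data.Nat.Solver as ℕ-Solver
open import Algebra.Properties.Semiring.Sum ℕ.+-*-semiring
  using () renaming (sum to Σℕ; sum-cong-≗ to Σℕ-cong; ∑-distrib-+ to Σℕ-+; *-distribˡ-sum to Σℕ-*ˡ)
open import Data.Product.Base using (_×_; _,_)
open import Data.Sum.Base using (inj₁; inj₂)
open import Data.Vec.Base using (Vec; []; _∷_; lookup; replicate; _[_]≔_)
import Data.Vec.Properties as Vec
import Data.Vec.Relation.Unary.Any as VecAny
open import Function.Base using (_∘_)
open import Relation.Binary.Bundles using (StrictPartialOrder)
open import Relation.Binary.Definitions using (DecidableEquality; tri<; tri≈; tri>)
open import Relation.Binary.PropositionalEquality as ≡ using (_≡_; _≢_; module ≡-Reasoning)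
import Relation.Binary.Reasoning.StrictPartialOrder as StrictReasoning
open import Relation.Binary.Structures using (IsStrictTotalOrder)
open import Relation.Nullary using (¬_; yes; no; does; contradiction)
open import Relation.Nullary.Decidable using (dec-true; dec-false)

-- The value of `ε` comes from Chebyshev's inequality for Y with deviation σY²: the failure
-- probability is at most σY²/σY⁴ = 1/σY², and μX - μY accounts for moving the centre from μY to μX.
-- Both estimates being two-valued, the bounds are obtained directly instead: either event can fail
-- only where the triangle is counted, which has probability 1/q.
--
-- For the sampling, induction on the whole distribution of the buffer is avoided. Only the means of
-- n and of n m are followed, in the forms "mean times t is M" and "mean times t (t - 1) is M (M -
-- 1)", because these left sides do not change from one step to the next. The sums over draws are
-- evaluated in ℕ, with evicted occurrences moved to the other side of each equation since
-- subtraction truncates there; only afterwards does `fromℕ` carry the results into the field.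

module RingSolverℤ {a ℓ} (R : CommutativeRing a ℓ) where
  open CommutativeRing R
  open import Algebra.Properties.Ring ring
  open import Algebra.Properties.Semiring.Mult.TCOptimised semiring
    using (×-homo-+; ×1-homo-*; 1+×) renaming (_×_ to _·_)
  open import Relation.Binary.Reasoning.Setoid setoid

  private
    -- Constants cancel only if equality of coefficients computes, so the coefficients are integers
    -- rather than ring elements. With the optimised multiple, `con (+ 1)`, `con (+ 2)` and
    -- `con ℤ.-1ℤ` evaluate to `1#`, `1# + 1#` and `- 1#`, the forms met in the goals below.
    ⟦_⟧ℤ : ℤ → Carrier
    ⟦ + n ⟧ℤ      = n · 1#
    ⟦ -[1+ n ] ⟧ℤ = - (suc n · 1#)

    -‿homo : ∀ i → ⟦ ℤ.- i ⟧ℤ ≈ - ⟦ i ⟧ℤ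
    -‿homo (+ zero)   = sym -0#≈0#
    -‿homo (+ suc n)  = refl
    -‿homo (-[1+ n ]) = sym (-‿involutive _)

    cancel-1 : ∀ x y → (1# + x) - (1# + y) ≈ x - y
    cancel-1 x y = begin
      (1# + x) - (1# + y)       ≈⟨ +-cong (+-comm 1# x) (sym (-‿+-comm 1# y)) ⟩
      (x + 1#) + (- 1# + - y)   ≈⟨ +-assoc x 1# _ ⟩
      x + (1# + (- 1# + - y))   ≈⟨ +-congˡ (+-assoc 1# (- 1#) (- y)) ⟨
      x + ((1# + - 1#) + - y)   ≈⟨ +-congˡ (+-congʳ (-‿inverseʳ 1#)) ⟩
      x + (0# + - y)            ≈⟨ +-congˡ (+-identityˡ _) ⟩
      x - y                     ∎

    ⊖-homo : ∀ m n → ⟦ m ℤ.⊖ n ⟧ℤ ≈ m · 1# - n · 1#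
    ⊖-homo m       zero    = sym (trans (+-congˡ -0#≈0#) (+-identityʳ _))
    ⊖-homo zero    (suc n) = sym (+-identityˡ _)
    ⊖-homo (suc m) (suc n) = begin
      ⟦ suc m ℤ.⊖ suc n ⟧ℤ           ≡⟨ ≡.cong ⟦_⟧ℤ (ℤ.[1+m]⊖[1+n]≡m⊖n m n) ⟩
      ⟦ m ℤ.⊖ n ⟧ℤ                   ≈⟨ ⊖-homo m n ⟩
      m · 1# - n · 1#                ≈⟨ cancel-1 _ _ ⟨
      (1# + m · 1#) - (1# + n · 1#)  ≈⟨ +-cong (1+× m 1#) (-‿cong (1+× n 1#)) ⟨
      suc m · 1# - suc n · 1#        ∎

    +-homo : ∀ i j → ⟦ i ℤ.+ j ⟧ℤ ≈ ⟦ i ⟧ℤ + ⟦ j ⟧ℤ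
    +-homo (+ m)    (+ n)    = ×-homo-+ 1# m n
    +-homo (+ m)    -[1+ n ] = ⊖-homo m (suc n)
    +-homo -[1+ m ] (+ n)    = trans (⊖-homo n (suc m)) (+-comm _ _)
    +-homo -[1+ m ] -[1+ n ] = begin
      - (suc (suc (m ℕ.+ n)) · 1#)          ≡⟨ ≡.cong (λ l → - (suc l · 1#)) (ℕ.+-suc m n) ⟨
      - ((suc m ℕ.+ suc n) · 1#)            ≈⟨ -‿cong (×-homo-+ 1# (suc m) (suc n)) ⟩
      - (suc m · 1# + suc n · 1#)           ≈⟨ -‿+-comm _ _ ⟨
      - (suc m · 1#) + - (suc n · 1#)       ∎

    *-homo⁺ : ∀ m j → ⟦ + m ℤ.* j ⟧ℤ ≈ m · 1# * ⟦ j ⟧ℤ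
    *-homo⁺ m (+ n)    = trans (reflexive (≡.cong ⟦_⟧ℤ (≡.sym (ℤ.pos-* m n)))) (×1-homo-* m n)
    *-homo⁺ m -[1+ n ] = begin
      ⟦ + m ℤ.* -[1+ n ] ⟧ℤ        ≡⟨ ≡.cong ⟦_⟧ℤ (ℤ.neg-distribʳ-* (+ m) (+ suc n)) ⟨
      ⟦ ℤ.- (+ m ℤ.* + suc n) ⟧ℤ   ≈⟨ -‿homo (+ m ℤ.* + suc n) ⟩
      - ⟦ + m ℤ.* + suc n ⟧ℤ       ≈⟨ -‿cong (*-homo⁺ m (+ suc n)) ⟩
      - (m · 1# * (suc n · 1#))    ≈⟨ -‿distribʳ-* _ _ ⟩
      m · 1# * - (suc n · 1#)      ∎

    *-homo : ∀ i j → ⟦ i ℤ.* j ⟧ℤ ≈ ⟦ i ⟧ℤ * ⟦ j ⟧ℤ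
    *-homo (+ m)    j = *-homo⁺ m j
    *-homo -[1+ m ] j = begin
      ⟦ -[1+ m ] ℤ.* j ⟧ℤ          ≡⟨ ≡.cong ⟦_⟧ℤ (ℤ.neg-distribˡ-* (+ suc m) j) ⟨
      ⟦ ℤ.- (+ suc m ℤ.* j) ⟧ℤ     ≈⟨ -‿homo (+ suc m ℤ.* j) ⟩
      - ⟦ + suc m ℤ.* j ⟧ℤ         ≈⟨ -‿cong (*-homo⁺ (suc m) j) ⟩
      - (suc m · 1# * ⟦ j ⟧ℤ)      ≈⟨ -‿distribˡ-* _ _ ⟩
      - (suc m · 1#) * ⟦ j ⟧ℤ      ∎

    homomorphism : ℤ.+-*-rawRing -Raw-AlmostCommutative⟶ fromCommutativeRing R
    homomorphism = record
      { ⟦_⟧ = ⟦_⟧ℤ ; +-homo = +-homo ; *-homo = *-homo ; -‿homo = -‿homo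
      ; 0-homo = refl ; 1-homo = refl }

    _coeff≟_ : ∀ i j → Maybe (⟦ i ⟧ℤ ≈ ⟦ j ⟧ℤ)
    i coeff≟ j with i ℤ.≟ j
    ... | yes i≡j = just (reflexive (≡.cong ⟦_⟧ℤ i≡j))
    ... | no  _   = nothing

  open RingSolver ℤ.+-*-rawRing (fromCommutativeRing R) homomorphism _coeff≟_ public
    using (solve; con; _:+_; _:*_; _:-_; :-_; _:=_)

-- Order and division in an ordered field.

module OrderedFieldProperties {k ℓ₁ ℓ₂} (K : OrderedField k ℓ₁ ℓ₂) where
  open OrderedField K
  open CommutativeRing commutativeRing public
    using (semiring; refl; sym; trans; reflexive; +-cong; +-congˡ; +-congʳ; +-comm; +-identityˡ
          ; +-identityʳ; *-cong; *-congˡ; *-congʳ; *-comm; *-assoc; *-identityˡ; *-identityʳ; zeroˡ; zeroʳ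
          ; -‿cong; -‿inverseʳ; distribʳ)
  open RingSolverℤ commutativeRing public
  open IsStrictTotalOrder isStrictTotalOrder public
    using (compare; irrefl; <-respˡ-≈; <-respʳ-≈; isStrictPartialOrder)
    renaming (trans to <-trans)

  strictPartialOrder : StrictPartialOrder _ _ _
  strictPartialOrder = record { isStrictPartialOrder = isStrictPartialOrder }

  module ≤-Reasoning = StrictReasoning strictPartialOrder
  open ≤-Reasoning

  x<y⇒0<y-x : ∀ {x y} → x < y → 0# < y - x
  x<y⇒0<y-x {x} x<y = <-respˡ-≈ (-‿inverseʳ x) (+-monoˡ-< (- x) x<y)

  0<y-x⇒x<y : ∀ {x y} → 0# < y - x → x < y
  0<y-x⇒x<y {x} {y} 0<y-x = begin-strict
    x            ≈⟨ +-identityˡ x ⟨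
    0# + x       <⟨ +-monoˡ-< x 0<y-x ⟩
    (y - x) + x  ≈⟨ solve 2 (λ x y → (y :- x) :+ x := y) refl x y ⟩
    y            ∎

  -- The pattern behind many inequalities below: `z` is an expression visibly positive from its
  -- factors, and the ring solver identifies it with the difference of the two sides.
  <-by : ∀ {x y z} → 0# < z → z ≈ y - x → x < y
  <-by 0<z z≈y-x = 0<y-x⇒x<y (<-respʳ-≈ z≈y-x 0<z)

  ≤-by : ∀ {x y z} → 0# ≤ z → z ≈ y - x → x ≤ y
  ≤-by (inj₁ 0<z) z≈y-x = inj₁ (<-by 0<z z≈y-x)
  ≤-by {x} {y} {z} (inj₂ 0≈z) z≈y-x = inj₂ (begin-equality
    x            ≈⟨ +-identityˡ x ⟨
    0# + x       ≈⟨ +-congʳ (trans 0≈z z≈y-x) ⟩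
    (y - x) + x  ≈⟨ solve 2 (λ x y → (y :- x) :+ x := y) refl x y ⟩
    y            ∎)

  x≤y⇒0≤y-x : ∀ {x y} → x ≤ y → 0# ≤ y - x
  x≤y⇒0≤y-x (inj₁ x<y) = inj₁ (x<y⇒0<y-x x<y)
  x≤y⇒0≤y-x {x} (inj₂ x≈y) = inj₂ (trans (sym (-‿inverseʳ x)) (+-congʳ x≈y))

  *-nonneg : ∀ {x y} → 0# ≤ x → 0# ≤ y → 0# ≤ x * y
  *-nonneg (inj₁ 0<x) (inj₁ 0<y) = inj₁ (*-pos 0<x 0<y)
  *-nonneg {x} (inj₁ _) (inj₂ 0≈y) = inj₂ (trans (sym (zeroʳ x)) (*-congˡ 0≈y))
  *-nonneg {y = y} (inj₂ 0≈x) _    = inj₂ (trans (sym (zeroˡ y)) (*-congʳ 0≈x))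

  +-pos : ∀ {x y} → 0# < x → 0# ≤ y → 0# < x + y
  +-pos {x} {y} 0<x 0≤y = begin-strict
    0#      ≤⟨ 0≤y ⟩
    y       ≈⟨ +-identityˡ y ⟨
    0# + y  <⟨ +-monoˡ-< y 0<x ⟩
    x + y   ∎

  +-nonneg : ∀ {x y} → 0# ≤ x → 0# ≤ y → 0# ≤ x + y
  +-nonneg (inj₁ 0<x) 0≤y = inj₁ (+-pos 0<x 0≤y)
  +-nonneg {y = y} (inj₂ 0≈x) 0≤y = begin
    0#      ≤⟨ 0≤y ⟩
    y       ≈⟨ +-identityˡ y ⟨
    0# + y  ≈⟨ +-congʳ 0≈x ⟩
    _       ∎

  *-monoˡ-≤ : ∀ {x y z} → 0# ≤ z → x ≤ y → x * z ≤ y * z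
  *-monoˡ-≤ {x} {y} {z} 0≤z x≤y = ≤-by (*-nonneg (x≤y⇒0≤y-x x≤y) 0≤z)
    (solve 3 (λ x y z → (y :- x) :* z := y :* z :- x :* z) refl x y z)

  *-monoˡ-< : ∀ {x y z} → 0# < z → x < y → x * z < y * z
  *-monoˡ-< {x} {y} {z} 0<z x<y = <-by (*-pos (x<y⇒0<y-x x<y) 0<z)
    (solve 3 (λ x y z → (y :- x) :* z := y :* z :- x :* z) refl x y z)

  *-mono-≤ : ∀ {x y z w} → 0# ≤ x → 0# ≤ w → x ≤ y → z ≤ w → x * z ≤ y * w
  *-mono-≤ {x} {y} {z} {w} 0≤x 0≤w x≤y z≤w =
    ≤-by (+-nonneg (*-nonneg 0≤x (x≤y⇒0≤y-x z≤w)) (*-nonneg (x≤y⇒0≤y-x x≤y) 0≤w))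
      (solve 4 (λ x y z w → x :* (w :- z) :+ (y :- x) :* w := y :* w :- x :* z) refl x y z w)

  -‿monoʳ-≤ : ∀ {x y} z → x ≤ y → z - y ≤ z - x
  -‿monoʳ-≤ {x} {y} z x≤y = ≤-by (x≤y⇒0≤y-x x≤y)
    (solve 3 (λ x y z → y :- x := (z :- x) :- (z :- y)) refl x y z)

  -‿monoʳ-< : ∀ {x y} z → x < y → z - y < z - x
  -‿monoʳ-< {x} {y} z x<y = <-by (x<y⇒0<y-x x<y)
    (solve 3 (λ x y z → y :- x := (z :- x) :- (z :- y)) refl x y z)

  0<x⇒x≉0 : ∀ {x} → 0# < x → ¬ x ≈ 0#
  0<x⇒x≉0 0<x x≈0 = irrefl (sym x≈0) 0<x

  ⁻¹-pos : ∀ {x} → 0# < x → 0# < x ⁻¹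
  ⁻¹-pos {x} 0<x with compare 0# (x ⁻¹)
  ... | tri< 0<x⁻¹ _ _ = 0<x⁻¹
  ... | tri≈ _ 0≈x⁻¹ _ = contradiction 0<1 (irrefl (begin-equality
    0#        ≈⟨ zeroʳ x ⟨
    x * 0#    ≈⟨ *-congˡ 0≈x⁻¹ ⟩
    x * x ⁻¹  ≈⟨ *-inverseʳ x (0<x⇒x≉0 0<x) ⟩
    1#        ∎))
  ... | tri> _ _ x⁻¹<0 = contradiction (begin-strict
    0#        <⟨ 0<1 ⟩
    1#        ≈⟨ *-inverseʳ x (0<x⇒x≉0 0<x) ⟨
    x * x ⁻¹  ≈⟨ *-comm _ _ ⟩
    x ⁻¹ * x  <⟨ *-monoˡ-< 0<x x⁻¹<0 ⟩
    0# * x    ≈⟨ zeroˡ x ⟩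
    0#        ∎) (irrefl refl)

  x*y/y≈x : ∀ x {y} → 0# < y → (x * y) / y ≈ x
  x*y/y≈x x {y} 0<y = begin-equality
    (x * y) * y ⁻¹  ≈⟨ *-assoc x y _ ⟩
    x * (y * y ⁻¹)  ≈⟨ *-congˡ (*-inverseʳ y (0<x⇒x≉0 0<y)) ⟩
    x * 1#          ≈⟨ *-identityʳ x ⟩
    x               ∎

  x/y*y≈x : ∀ x {y} → 0# < y → x / y * y ≈ x
  x/y*y≈x x {y} 0<y =
    trans (solve 3 (λ x y z → (x :* z) :* y := (x :* y) :* z) refl x y (y ⁻¹)) (x*y/y≈x x 0<y)

  *-cancelʳ-< : ∀ {x y z} → 0# < z → x * z < y * z → x < y
  *-cancelʳ-< {x} {y} {z} 0<z xz<yz = begin-strict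
    x            ≈⟨ x*y/y≈x x 0<z ⟨
    (x * z) / z  <⟨ *-monoˡ-< (⁻¹-pos 0<z) xz<yz ⟩
    (y * z) / z  ≈⟨ x*y/y≈x y 0<z ⟩
    y            ∎

  *-cancelʳ-≤ : ∀ {x y z} → 0# < z → x * z ≤ y * z → x ≤ y
  *-cancelʳ-≤ {x} {y} {z} 0<z xz≤yz = begin
    x            ≈⟨ x*y/y≈x x 0<z ⟨
    (x * z) / z  ≤⟨ *-monoˡ-≤ (inj₁ (⁻¹-pos 0<z)) xz≤yz ⟩
    (y * z) / z  ≈⟨ x*y/y≈x y 0<z ⟩
    y            ∎

  private
    x/y*yw : ∀ x {y} w → 0# < y → x / y * (y * w) ≈ x * w
    x/y*yw x {y} w 0<y = trans (sym (*-assoc _ y w)) (*-congʳ (x/y*y≈x x 0<y))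

  x*w≤z*y⇒x/y≤z/w : ∀ {x y z w} → 0# < y → 0# < w → x * w ≤ z * y → x / y ≤ z / w
  x*w≤z*y⇒x/y≤z/w {x} {y} {z} {w} 0<y 0<w xw≤zy = *-cancelʳ-≤ (*-pos 0<y 0<w) (begin
    x / y * (y * w)  ≈⟨ x/y*yw x w 0<y ⟩
    x * w            ≤⟨ xw≤zy ⟩
    z * y            ≈⟨ x/y*yw z y 0<w ⟨
    z / w * (w * y)  ≈⟨ *-congˡ (*-comm w y) ⟩
    z / w * (y * w)  ∎)

  x*w<z*y⇒x/y<z/w : ∀ {x y z w} → 0# < y → 0# < w → x * w < z * y → x / y < z / w
  x*w<z*y⇒x/y<z/w {x} {y} {z} {w} 0<y 0<w xw<zy = *-cancelʳ-< (*-pos 0<y 0<w) (begin-strict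
    x / y * (y * w)  ≈⟨ x/y*yw x w 0<y ⟩
    x * w            <⟨ xw<zy ⟩
    z * y            ≈⟨ x/y*yw z y 0<w ⟨
    z / w * (w * y)  ≈⟨ *-congˡ (*-comm w y) ⟩
    z / w * (y * w)  ∎)

  0≤1 : 0# ≤ 1#
  0≤1 = inj₁ 0<1

  fromℕ-nonneg : ∀ n → 0# ≤ fromℕ n
  fromℕ-nonneg zero    = inj₂ refl
  fromℕ-nonneg (suc n) = inj₁ (+-pos 0<1 (fromℕ-nonneg n))

  fromℕ-pos : ∀ n → 0# < fromℕ (suc n)
  fromℕ-pos n = +-pos 0<1 (fromℕ-nonneg n)

  ∣x∣<y : ∀ {x y} → x < y → - x < y → ∣ x ∣ < y
  ∣x∣<y {x} x<y -x<y with x <? 0#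
  ... | yes _ = -x<y
  ... | no  _ = x<y

  ⟦_⟧ : Bool → Carrier
  ⟦ b ⟧ = if b then 1# else 0#

  0≤⟦b⟧ : ∀ b → 0# ≤ ⟦ b ⟧
  0≤⟦b⟧ true  = 0≤1
  0≤⟦b⟧ false = inj₂ refl

-- Expectation over independent uniform draws.

module Expectation {k ℓ₁ ℓ₂} (K : OrderedField k ℓ₁ ℓ₂) where
  open OrderedField K
  open Probability K
  open OrderedFieldProperties K
  open ≤-Reasoning
  open import Algebra.Properties.Semiring.Sum semiring public
    using (sum-cong-≋; ∑-distrib-+; *-distribˡ-sum; sum-replicate)
  open import Algebra.Properties.Semiring.Mult semiring using (×-assoc-*; ×-congʳ)

  sum-const : ∀ n x → sum {n} (λ _ → x) ≈ fromℕ n * x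
  sum-const n x = begin-equality
    sum {n} (λ _ → x)  ≈⟨ sum-replicate n ⟩
    n · x              ≈⟨ ×-congʳ n (*-identityˡ x) ⟨
    n · (1# * x)       ≈⟨ ×-assoc-* n 1# x ⟨
    n · 1# * x         ∎

  sum-nonneg : ∀ {n} {f : Fin n → Carrier} → (∀ i → 0# ≤ f i) → 0# ≤ sum f
  sum-nonneg {zero}  0≤f = inj₂ refl
  sum-nonneg {suc n} 0≤f = +-nonneg (0≤f zero) (sum-nonneg (0≤f ∘ suc))

  𝔼-cong : ∀ {T} {Z W : Draws T → Carrier} → (∀ ω → Z ω ≈ W ω) → 𝔼 Z ≈ 𝔼 W
  𝔼-cong {zero}  Z≈W = Z≈W _
  𝔼-cong {suc T} Z≈W = 𝔼-cong λ ω → *-congʳ (sum-cong-≋ λ i → Z≈W (ω , i))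

  𝔼-+ : ∀ {T} (Z W : Draws T → Carrier) → 𝔼 (λ ω → Z ω + W ω) ≈ 𝔼 Z + 𝔼 W
  𝔼-+ {zero}  Z W = refl
  𝔼-+ {suc T} Z W = trans
    (𝔼-cong λ ω → trans (*-congʳ (∑-distrib-+ (λ i → Z (ω , i)) (λ i → W (ω , i)))) (distribʳ _ _ _))
    (𝔼-+ {T} _ _)

  𝔼-*ˡ : ∀ {T} x (Z : Draws T → Carrier) → 𝔼 (λ ω → x * Z ω) ≈ x * 𝔼 Z
  𝔼-*ˡ {zero}  x Z = refl
  𝔼-*ˡ {suc T} x Z = trans
    (𝔼-cong λ ω → trans (*-congʳ (sym (*-distribˡ-sum x λ i → Z (ω , i)))) (*-assoc _ _ _))
    (𝔼-*ˡ {T} x _)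

  𝔼-nonneg : ∀ {T} {Z : Draws T → Carrier} → (∀ ω → 0# ≤ Z ω) → 0# ≤ 𝔼 Z
  𝔼-nonneg {zero}  0≤Z = 0≤Z _
  𝔼-nonneg {suc T} 0≤Z =
    𝔼-nonneg λ ω → *-nonneg (sum-nonneg λ i → 0≤Z (ω , i)) (inj₁ (⁻¹-pos (fromℕ-pos T)))

  average-const : ∀ T x → sum {suc T} (λ _ → x) / fromℕ (suc T) ≈ x
  average-const T x = begin-equality
    sum {suc T} (λ _ → x) / fromℕ (suc T)   ≈⟨ *-congʳ (sum-const (suc T) x) ⟩
    (fromℕ (suc T) * x) / fromℕ (suc T)     ≈⟨ *-congʳ (*-comm (fromℕ (suc T)) x) ⟩
    (x * fromℕ (suc T)) / fromℕ (suc T)     ≈⟨ x*y/y≈x x (fromℕ-pos T) ⟩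
    x                                       ∎

  -- Each draw after time `t` averages a value that does not depend on it, and so drops out. This
  -- transfers a probability at the formation time to the sample space of the current time.
  𝔼-prefix : ∀ {t T} (t≤T : t ≤′ T) (Z : Draws t → Carrier) → 𝔼 (λ ω → Z (prefix t≤T ω)) ≈ 𝔼 Z
  𝔼-prefix (≤′-reflexive ≡.refl) Z = refl
  𝔼-prefix (≤′-step {n} t≤T)     Z =
    trans (𝔼-cong λ ω → average-const n (Z (prefix t≤T ω))) (𝔼-prefix t≤T Z)

  𝔼-const : ∀ {T} x → 𝔼 {T} (λ _ → x) ≈ x
  𝔼-const {zero}  x = refl
  𝔼-const {suc T} x = trans (𝔼-cong {T} λ ω → average-const T x) (𝔼-const {T} x)

  -- Clearing the denominator of the last average leaves a plain sum over the draws, which the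
  -- counting identities in ℕ can evaluate.
  𝔼-step : ∀ {T} (Z : Draws (suc T) → Carrier) →
           𝔼 Z * fromℕ (suc T) ≈ 𝔼 (λ ω → sum λ i → Z (ω , i))
  𝔼-step {T} Z = begin-equality
    𝔼 Z * fromℕ (suc T)                            ≈⟨ *-comm _ _ ⟩
    fromℕ (suc T) * 𝔼 Z                            ≈⟨ 𝔼-*ˡ {T} (fromℕ (suc T)) (λ ω → sum (λ i → Z (ω , i)) / fromℕ (suc T)) ⟨
    𝔼 (λ ω → fromℕ (suc T) * (sum (λ i → Z (ω , i)) / fromℕ (suc T)))
      ≈⟨ 𝔼-cong {T} (λ ω → trans (*-comm _ _) (x/y*y≈x _ (fromℕ-pos T))) ⟩
    𝔼 (λ ω → sum λ i → Z (ω , i))                  ∎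

  𝔼-mono : ∀ {T} {Z W : Draws T → Carrier} → (∀ ω → Z ω ≤ W ω) → 𝔼 Z ≤ 𝔼 W
  𝔼-mono {T} {Z} {W} Z≤W = ≤-by (𝔼-nonneg λ ω → x≤y⇒0≤y-x (Z≤W ω)) (begin-equality
    𝔼 (λ ω → W ω - Z ω)              ≈⟨ 𝔼-cong (λ ω → solve 2 (λ w z → w :- z := w :+ con ℤ.-1ℤ :* z) refl (W ω) (Z ω)) ⟩
    𝔼 (λ ω → W ω + (- 1#) * Z ω)     ≈⟨ 𝔼-+ W (λ ω → (- 1#) * Z ω) ⟩
    𝔼 W + 𝔼 (λ ω → (- 1#) * Z ω)     ≈⟨ +-congˡ (𝔼-*ˡ (- 1#) Z) ⟩
    𝔼 W + (- 1#) * 𝔼 Z               ≈⟨ solve 2 (λ w z → w :+ con ℤ.-1ℤ :* z := w :- z) refl (𝔼 W) (𝔼 Z) ⟩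
    𝔼 W - 𝔼 Z                        ∎)

-- Moments and tail bounds of multiples of an indicator.

module TwoPoint {k ℓ₁ ℓ₂} (K : OrderedField k ℓ₁ ℓ₂) where
  open OrderedField K
  open Probability K
  open OrderedFieldProperties K
  open Expectation K
  open ≤-Reasoning

  module _ {T} (b : Draws T → Bool) (q : Carrier) (𝔼b*q≈1 : 𝔼 (λ ω → ⟦ b ω ⟧) * q ≈ 1#) where

    p : Carrier
    p = 𝔼 λ ω → ⟦ b ω ⟧

    module _ {Z : Draws T → Carrier} {c} (Z≈ : ∀ ω → Z ω ≈ c * (q * ⟦ b ω ⟧)) where

      𝔼-scaled : 𝔼 Z ≈ c
      𝔼-scaled = begin-equality
        𝔼 Z                              ≈⟨ 𝔼-cong (λ ω → trans (Z≈ ω) (sym (*-assoc c q _))) ⟩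
        𝔼 (λ ω → c * q * ⟦ b ω ⟧)        ≈⟨ 𝔼-*ˡ (c * q) (λ ω → ⟦ b ω ⟧) ⟩
        c * q * p                        ≈⟨ solve 3 (λ c q p → c :* q :* p := c :* (p :* q)) refl c q p ⟩
        c * (p * q)                      ≈⟨ *-congˡ 𝔼b*q≈1 ⟩
        c * 1#                           ≈⟨ *-identityʳ c ⟩
        c                                ∎

      -- An indicator b equals its own square, so (c q b - c)² = c² q (q - 2) b + c² is affine in b,
      -- and its mean follows from p q = 1.
      Var-scaled : Var Z ≈ c * (c * (q - 1#))
      Var-scaled = begin-equality
        Var Z                                              ≈⟨ 𝔼-cong square ⟩
        𝔼 (λ ω → c * c * (q * (q - 2#)) * ⟦ b ω ⟧ + c * c) ≈⟨ 𝔼-+ (λ ω → c * c * (q * (q - 2#)) * ⟦ b ω ⟧) (λ _ → c * c) ⟩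
        𝔼 (λ ω → c * c * (q * (q - 2#)) * ⟦ b ω ⟧) + 𝔼 {T} (λ _ → c * c)
          ≈⟨ +-cong (𝔼-*ˡ (c * c * (q * (q - 2#))) (λ ω → ⟦ b ω ⟧)) (𝔼-const {T} (c * c)) ⟩
        c * c * (q * (q - 2#)) * p + c * c
          ≈⟨ solve 3 (λ c q p → c :* c :* (q :* (q :- con (+ 2))) :* p :+ c :* c
                             := c :* c :* (q :- con (+ 2)) :* (p :* q) :+ c :* c) refl c q p ⟩
        c * c * (q - 2#) * (p * q) + c * c                 ≈⟨ +-congʳ (*-congˡ 𝔼b*q≈1) ⟩
        c * c * (q - 2#) * 1# + c * c
          ≈⟨ solve 2 (λ c q → c :* c :* (q :- con (+ 2)) :* con (+ 1) :+ c :* c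
                           := c :* (c :* (q :- con (+ 1)))) refl c q ⟩
        c * (c * (q - 1#))                                 ∎
        where
        square′ : ∀ x → (c * (q * ⟦ x ⟧) - c) ² ≈ c * c * (q * (q - 2#)) * ⟦ x ⟧ + c * c
        square′ true  = solve 2 (λ c q → (c :* (q :* con (+ 1)) :- c) :* (c :* (q :* con (+ 1)) :- c)
          := c :* c :* (q :* (q :- con (+ 2))) :* con (+ 1) :+ c :* c) refl c q
        square′ false = solve 2 (λ c q → (c :* (q :* con (+ 0)) :- c) :* (c :* (q :* con (+ 0)) :- c)
          := c :* c :* (q :* (q :- con (+ 2))) :* con (+ 0) :+ c :* c) refl c q
        square : ∀ ω → (Z ω - 𝔼 Z) ² ≈ c * c * (q * (q - 2#)) * ⟦ b ω ⟧ + c * c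
        square ω = trans (*-cong e e) (square′ (b ω))
          where e = +-cong (Z≈ ω) (-‿cong 𝔼-scaled)

      -- Where Z vanishes, |Z − m| = 1 < ε.
      Pr-scaled : ∀ {m ε} → m ≈ 1# → 1# < ε → 1# - p ≤ Pr (λ ω → ∣ Z ω - m ∣ <? ε)
      Pr-scaled {m} {ε} m≈1 1<ε = begin
        1# - p                                       ≈⟨ solve 1 (λ p → con (+ 1) :- p := con ℤ.-1ℤ :* p :+ con (+ 1)) refl p ⟩
        - 1# * p + 1#                                ≈⟨ +-cong (𝔼-*ˡ (- 1#) (λ ω → ⟦ b ω ⟧)) (𝔼-const {T} 1#) ⟨
        𝔼 (λ ω → - 1# * ⟦ b ω ⟧) + 𝔼 {T} (λ _ → 1#)  ≈⟨ 𝔼-+ (λ ω → - 1# * ⟦ b ω ⟧) (λ _ → 1#) ⟨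
        𝔼 (λ ω → - 1# * ⟦ b ω ⟧ + 1#)                ≤⟨ 𝔼-mono (λ ω → pointwise ω (b ω) (Z≈ ω)) ⟩
        Pr (λ ω → ∣ Z ω - m ∣ <? ε)                  ∎
        where
        pointwise : ∀ ω x → Z ω ≈ c * (q * ⟦ x ⟧) → - 1# * ⟦ x ⟧ + 1# ≤ ⟦ does (∣ Z ω - m ∣ <? ε) ⟧
        pointwise ω true  _ = begin
          - 1# * 1# + 1#  ≈⟨ solve 0 (con ℤ.-1ℤ :* con (+ 1) :+ con (+ 1) := con (+ 0)) refl ⟩
          0#              ≤⟨ 0≤⟦b⟧ (does (∣ Z ω - m ∣ <? ε)) ⟩
          ⟦ does (∣ Z ω - m ∣ <? ε) ⟧ ∎
        pointwise ω false Zω≈ with ∣ Z ω - m ∣ <? ε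
        ... | yes _ = inj₂ (solve 0 (con ℤ.-1ℤ :* con (+ 0) :+ con (+ 1) := con (+ 1)) refl)
        ... | no  ≮ = contradiction (∣x∣<y {Z ω - m} below above) ≮
          where
          Z-m≈-1 : Z ω - m ≈ - 1#
          Z-m≈-1 = begin-equality
            Z ω - m              ≈⟨ +-cong Zω≈ (-‿cong m≈1) ⟩
            c * (q * 0#) - 1#    ≈⟨ solve 2 (λ c q → c :* (q :* con (+ 0)) :- con (+ 1) := con ℤ.-1ℤ) refl c q ⟩
            - 1#                 ∎
          below : Z ω - m < ε
          below = begin-strict
            Z ω - m  ≈⟨ Z-m≈-1 ⟩
            - 1#     <⟨ <-by (+-pos 0<1 0≤1) (solve 0 (con (+ 1) :+ con (+ 1) := con (+ 1) :- con ℤ.-1ℤ) refl) ⟩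
            1#       <⟨ 1<ε ⟩
            ε        ∎
          above : - (Z ω - m) < ε
          above = begin-strict
            - (Z ω - m)  ≈⟨ -‿cong Z-m≈-1 ⟩
            - - 1#       ≈⟨ solve 0 (:- con ℤ.-1ℤ := con (+ 1)) refl ⟩
            1#           <⟨ 1<ε ⟩
            ε            ∎

    module Comparison
      {δ c} (δ<1 : δ < 1#) (1-δ≤c : 1# - δ ≤ c) (c≤1 : c ≤ 1#)
      ([2-δ]/[1-δ]<q : (2# - δ) / (1# - δ) < q)
      {X Y : Draws T → Carrier} (X≈ : ∀ ω → X ω ≈ q * ⟦ b ω ⟧) (Y≈ : ∀ ω → Y ω ≈ c * (q * ⟦ b ω ⟧)) where

      private
        X≈′ : ∀ ω → X ω ≈ 1# * (q * ⟦ b ω ⟧)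
        X≈′ ω = trans (X≈ ω) (sym (*-identityˡ _))

        -- σX² = r and σY² = c u.
        r u ε : Carrier
        r = q - 1#
        u = c * r
        ε = (𝔼 X - 𝔼 Y) + Var Y

        0<1-δ : 0# < 1# - δ
        0<1-δ = x<y⇒0<y-x δ<1

        -- Clearing the denominator turns the hypothesis into 2 - δ < q (1 - δ); subtracting 1 - δ
        -- from both sides leaves this.
        1<[1-δ]r : 1# < (1# - δ) * r
        1<[1-δ]r = <-by (x<y⇒0<y-x (begin-strict
            2# - δ                               ≈⟨ x/y*y≈x (2# - δ) 0<1-δ ⟨
            (2# - δ) / (1# - δ) * (1# - δ)       <⟨ *-monoˡ-< 0<1-δ [2-δ]/[1-δ]<q ⟩
            q * (1# - δ)                         ∎))
          (solve 2 (λ d q → q :* (con (+ 1) :- d) :- (con (+ 2) :- d)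
                         := (con (+ 1) :- d) :* (q :- con (+ 1)) :- con (+ 1)) refl δ q)

        0<r : 0# < r
        0<r = *-cancelʳ-< 0<1-δ (begin-strict
          0# * (1# - δ)   ≈⟨ zeroˡ _ ⟩
          0#              <⟨ 0<1 ⟩
          1#              <⟨ 1<[1-δ]r ⟩
          (1# - δ) * r    ≈⟨ *-comm _ _ ⟩
          r * (1# - δ)    ∎)

        1<u : 1# < u
        1<u = begin-strict
          1#             <⟨ 1<[1-δ]r ⟩
          (1# - δ) * r   ≤⟨ *-monoˡ-≤ (inj₁ 0<r) 1-δ≤c ⟩
          c * r          ∎

        0<c : 0# < c
        0<c = begin-strict
          0#      <⟨ 0<1-δ ⟩
          1# - δ  ≤⟨ 1-δ≤c ⟩
          c       ∎

        0<u : 0# < u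
        0<u = <-trans 0<1 1<u

        0<q : 0# < q
        0<q = <-trans 0<r (<-by 0<1 (solve 1 (λ q → con (+ 1) := q :- (q :- con (+ 1))) refl q))

        r≤q : r ≤ q
        r≤q = ≤-by 0≤1 (solve 1 (λ q → con (+ 1) := q :- (q :- con (+ 1))) refl q)

        u≤r : u ≤ r
        u≤r = begin
          c * r   ≤⟨ *-monoˡ-≤ (inj₁ 0<r) c≤1 ⟩
          1# * r  ≈⟨ *-identityˡ r ⟩
          r       ∎

        cu≤q : c * u ≤ q
        cu≤q = begin
          c * u   ≤⟨ *-monoˡ-≤ (inj₁ 0<u) c≤1 ⟩
          1# * u  ≈⟨ *-identityˡ u ⟩
          u       ≤⟨ u≤r ⟩
          r       ≤⟨ r≤q ⟩
          q       ∎

        σX²≈r : Var X ≈ r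
        σX²≈r = trans (Var-scaled X≈′) (trans (*-identityˡ _) (*-identityˡ r))

        σY²≈cu : Var Y ≈ c * u
        σY²≈cu = Var-scaled Y≈

        0<cu : 0# < c * u
        0<cu = *-pos 0<c 0<u

        0<σY² : 0# < Var Y
        0<σY² = <-respʳ-≈ (sym σY²≈cu) 0<cu

        -- A convex combination of `1#` and `u` with weight `c` on `u`. Since `1# < u` and 0 < c ≤
        -- 1, it lies strictly above `1#` and not above `u`.
        ε≈ : ε ≈ (1# - c) + c * u
        ε≈ = +-cong (+-cong (𝔼-scaled X≈′) (-‿cong (𝔼-scaled Y≈))) σY²≈cu

        1<ε : 1# < ε
        1<ε = <-respʳ-≈ (sym ε≈) (<-by (*-pos 0<c (x<y⇒0<y-x 1<u))
          (solve 2 (λ c u → c :* (u :- con (+ 1)) := ((con (+ 1) :- c) :+ c :* u) :- con (+ 1)) refl c u))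

        0<ε : 0# < ε
        0<ε = <-trans 0<1 1<ε

        -- As `1# < u`, the gap between `ε` and `u` vanishes only if `c ≈ 1#`; the strictness of the
        -- comparison hinges on this factor.
        u-ε : (1# - c) * (u - 1#) ≈ u - ((1# - c) + c * u)
        u-ε = solve 2 (λ c u → (con (+ 1) :- c) :* (u :- con (+ 1))
                            := u :- ((con (+ 1) :- c) :+ c :* u)) refl c u

        ε≤u : ε ≤ u
        ε≤u = begin
          ε                  ≈⟨ ε≈ ⟩
          (1# - c) + c * u   ≤⟨ ≤-by (*-nonneg (x≤y⇒0≤y-x c≤1) (inj₁ (x<y⇒0<y-x 1<u))) u-ε ⟩
          u                  ∎

        ε<u : c < 1# → ε < u
        ε<u c<1 = begin-strict
          ε                  ≈⟨ ε≈ ⟩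
          (1# - c) + c * u   <⟨ <-by (*-pos (x<y⇒0<y-x c<1) (x<y⇒0<y-x 1<u)) u-ε ⟩
          u                  ∎

        ε²≤u² : ε ² ≤ u ²
        ε²≤u² = *-mono-≤ (inj₁ 0<ε) (inj₁ 0<u) ε≤u ε≤u

        u²≈σX²σY² : u ² ≈ Var X * Var Y
        u²≈σX²σY² = trans (solve 2 (λ c r → (c :* r) :* (c :* r) := r :* (c :* (c :* r))) refl c r)
                          (sym (*-cong σX²≈r σY²≈cu))

        p≤1/σY² : p ≤ 1# / Var Y
        p≤1/σY² = *-cancelʳ-≤ 0<σY² (begin
          p * Var Y           ≈⟨ *-congˡ σY²≈cu ⟩
          p * (c * u)         ≤⟨ *-mono-≤ (𝔼-nonneg λ ω → 0≤⟦b⟧ (b ω)) (inj₁ 0<q) (inj₂ refl) cu≤q ⟩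
          p * q               ≈⟨ 𝔼b*q≈1 ⟩
          1#                  ≈⟨ x/y*y≈x 1# 0<σY² ⟨
          1# / Var Y * Var Y  ∎)

        1/σY²≤σX²/ε² : 1# / Var Y ≤ Var X / (ε ²)
        1/σY²≤σX²/ε² = x*w≤z*y⇒x/y≤z/w 0<σY² (*-pos 0<ε 0<ε) (begin
          1# * ε ²       ≈⟨ *-identityˡ _ ⟩
          ε ²            ≤⟨ ε²≤u² ⟩
          u ²            ≈⟨ u²≈σX²σY² ⟩
          Var X * Var Y  ∎)

      𝔼X≈1 : 𝔼 X ≈ 1#
      𝔼X≈1 = 𝔼-scaled X≈′

      Y-bound : 1# - 1# / Var Y ≤ Pr (λ ω → ∣ Y ω - 𝔼 X ∣ <? ε)
      Y-bound = begin
        1# - 1# / Var Y                 ≤⟨ -‿monoʳ-≤ 1# p≤1/σY² ⟩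
        1# - p                          ≤⟨ Pr-scaled Y≈ 𝔼X≈1 1<ε ⟩
        Pr (λ ω → ∣ Y ω - 𝔼 X ∣ <? ε)  ∎

      bounds-≤ : 1# - Var X / (ε ²) ≤ 1# - 1# / Var Y
      bounds-≤ = -‿monoʳ-≤ 1# 1/σY²≤σX²/ε²

      -- The stronger bound found for Y is valid for X as well, and by `bounds-≤` the bound wanted
      -- here is no larger.
      X-bound : 1# - Var X / (ε ²) ≤ Pr (λ ω → ∣ X ω - 𝔼 X ∣ <? ε)
      X-bound = begin
        1# - Var X / (ε ²)              ≤⟨ bounds-≤ ⟩
        1# - 1# / Var Y                 ≤⟨ -‿monoʳ-≤ 1# p≤1/σY² ⟩
        1# - p                          ≤⟨ Pr-scaled X≈′ 𝔼X≈1 1<ε ⟩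
        Pr (λ ω → ∣ X ω - 𝔼 X ∣ <? ε)  ∎

      bounds-< : c < 1# → 1# - Var X / (ε ²) < 1# - 1# / Var Y
      bounds-< c<1 = -‿monoʳ-< 1# (x*w<z*y⇒x/y<z/w 0<σY² (*-pos 0<ε 0<ε) (begin-strict
        1# * ε ²       ≈⟨ *-identityˡ _ ⟩
        ε ²            ≤⟨ *-monoˡ-≤ (inj₁ 0<ε) ε≤u ⟩
        u * ε          ≈⟨ *-comm u ε ⟩
        ε * u          <⟨ *-monoˡ-< 0<u (ε<u c<1) ⟩
        u ²            ≈⟨ u²≈σX²σY² ⟩
        Var X * Var Y  ∎))

-- Sums over draws in ℕ, and equivalence of edges.

open ≡ using (refl; sym; trans; cong; cong₂; subst)

Σℕ-const : ∀ n x → Σℕ {n} (λ _ → x) ≡ n ℕ.* x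
Σℕ-const zero    x = refl
Σℕ-const (suc n) x = cong (x ℕ.+_) (Σℕ-const n x)

module _ {v} {V : Set v} where

  ~-sym : {e f : Edge V} → e ~ f → f ~ e
  ~-sym (inj₁ (refl , refl)) = inj₁ (refl , refl)
  ~-sym (inj₂ (refl , refl)) = inj₂ (refl , refl)

  ~-trans : {e f g : Edge V} → e ~ f → f ~ g → e ~ g
  ~-trans (inj₁ (refl , refl)) f~g                  = f~g
  ~-trans (inj₂ (refl , refl)) (inj₁ (refl , refl)) = inj₂ (refl , refl)
  ~-trans (inj₂ (refl , refl)) (inj₂ (refl , refl)) = inj₁ (refl , refl)

-- The value of f at the drawn slot, or 0 if the draw discards the new edge.
atSlot : ∀ {M n} → (Fin M → ℕ) → Fin n → ℕ
atSlot {M} f i with toℕ i ℕ.<? M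
... | yes i<M = f (fromℕ< i<M)
... | no  _   = 0

atSlot-suc : ∀ {M n} (f : Fin (suc M) → ℕ) (i : Fin n) → atSlot f (suc i) ≡ atSlot (f ∘ suc) i
atSlot-suc {M} f i with suc (toℕ i) ℕ.<? suc M | toℕ i ℕ.<? M
... | yes _         | yes _   = refl
... | no  _         | no _    = refl
... | yes (s≤s i<M) | no i≮M  = contradiction i<M i≮M
... | no 1+i≮1+M    | yes i<M = contradiction (s≤s i<M) 1+i≮1+M

-- As `M ℕ.≤ n`, each slot is named by exactly one of the `n` draws, and the remaining draws
-- contribute 0.
Σ-atSlot : ∀ {M n} (f : Fin M → ℕ) → M ℕ.≤ n → Σℕ {n} (atSlot f) ≡ Σℕ f
Σ-atSlot {zero}  {n}     f _         = trans (Σℕ-const n 0) (ℕ.*-zeroʳ n)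
Σ-atSlot {suc M} {suc n} f (s≤s M≤n) = cong (f zero ℕ.+_)
  (trans (Σℕ-cong {n} (atSlot-suc f)) (Σ-atSlot (f ∘ suc) M≤n))

-- Occurrences of edges under one sampling step.

module Occurrences {v} {V : Set v} (_≟_ : DecidableEquality V) (M : ℕ) where
  open Reservoir _≟_ M

  occ : Edge V → Maybe (Edge V) → ℕ
  occ e x = if does (MaybeAny.dec (e ~?_) x) then 1 else 0

  -- A sum over slots instead of a membership test: overwriting a slot changes a single term, and
  -- the result can be summed over all draws.
  count : ∀ {m} → Edge V → Vec (Maybe (Edge V)) m → ℕ
  count e D = Σℕ λ u → occ e (lookup D u)

  count-replicate : ∀ e m → count e (replicate m nothing) ≡ 0
  count-replicate e zero    = refl
  count-replicate e (suc m) = count-replicate e m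

  count-update : ∀ {m} e (D : Vec _ m) u x →
                 count e (D [ u ]≔ x) ℕ.+ occ e (lookup D u) ≡ count e D ℕ.+ occ e x
  count-update e (y ∷ D) zero x =
    solve 3 (λ x y c → (x :+ c) :+ y := (y :+ c) :+ x) refl (occ e x) (occ e y) (count e D)
    where open ℕ-Solver.+-*-Solver
  count-update e (y ∷ D) (suc u) x = begin
    (occ e y ℕ.+ count e (D [ u ]≔ x)) ℕ.+ occ e (lookup D u)  ≡⟨ ℕ.+-assoc (occ e y) _ _ ⟩
    occ e y ℕ.+ (count e (D [ u ]≔ x) ℕ.+ occ e (lookup D u))  ≡⟨ cong (occ e y ℕ.+_) (count-update e D u x) ⟩
    occ e y ℕ.+ (count e D ℕ.+ occ e x)                        ≡⟨ ℕ.+-assoc (occ e y) _ _ ⟨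
    (occ e y ℕ.+ count e D) ℕ.+ occ e x                        ∎
    where open ≡-Reasoning

  ∉⇒count≡0 : ∀ {m} e (D : Vec (Maybe (Edge V)) m) →
              ¬ VecAny.Any (MaybeAny.Any (e ~_)) D → count e D ≡ 0
  ∉⇒count≡0 e []      e∉D = refl
  ∉⇒count≡0 e (x ∷ D) e∉D with MaybeAny.dec (e ~?_) x
  ... | yes e~x = contradiction (VecAny.here e~x) e∉D
  ... | no  _   = ∉⇒count≡0 e D (e∉D ∘ VecAny.there)

  ∈⇒1≤count : ∀ {m} e (D : Vec (Maybe (Edge V)) m) →
              VecAny.Any (MaybeAny.Any (e ~_)) D → 1 ℕ.≤ count e D
  ∈⇒1≤count e (x ∷ D) (VecAny.here e~x)  with MaybeAny.dec (e ~?_) x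
  ... | yes _  = s≤s z≤n
  ... | no e≁x = contradiction e~x e≁x
  ∈⇒1≤count e (x ∷ D) (VecAny.there e∈D) =
    ℕ.≤-trans (∈⇒1≤count e D e∈D) (ℕ.m≤n+m _ (occ e x))

  count≡indicator : ∀ e D → count e D ℕ.≤ 1 → count e D ≡ (if does (e ∈? D) then 1 else 0)
  count≡indicator e D count≤1 with e ∈? D
  ... | yes e∈D = ℕ.≤-antisym count≤1 (∈⇒1≤count e D e∈D)
  ... | no  e∉D = ∉⇒count≡0 e D e∉D

  module _ {t} (g : Edge V) (i : Fin (suc t)) (D : Buffer) where

    step-fill : (t<M : t ℕ.< M) → step t g i D ≡ D [ fromℕ< t<M ]≔ just g
    step-fill t<M with t ℕ.<? M
    ... | yes _  = refl
    ... | no t≮M = contradiction t<M t≮M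

    -- With `atSlot` one equation covers both outcomes: if the new edge is discarded, both `atSlot`
    -- terms are 0 and the buffer is unchanged.
    count-step : M ℕ.≤ t → ∀ e →
      count e (step t g i D) ℕ.+ atSlot (occ e ∘ lookup D) i ≡ count e D ℕ.+ atSlot {M} (λ _ → occ e (just g)) i
    count-step M≤t e with t ℕ.<? M
    ... | yes t<M = contradiction M≤t (ℕ.<⇒≱ t<M)
    ... | no  _ with toℕ i ℕ.<? M
    ...   | yes i<M = count-update e D (fromℕ< i<M) (just g)
    ...   | no  _   = refl

    -- In contrast to `count-step` this includes the filling phase, so inductions from the empty
    -- buffer can use it at every step.
    count-step-≤ : ∀ e → count e (step t g i D) ℕ.≤ count e D ℕ.+ occ e (just g)
    count-step-≤ e with t ℕ.<? M
    ... | yes t<M = ℕ.≤-trans (ℕ.m≤m+n _ _) (ℕ.≤-reflexive (count-update e D (fromℕ< t<M) (just g)))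
    ... | no  _ with toℕ i ℕ.<? M
    ...   | yes i<M = ℕ.≤-trans (ℕ.m≤m+n _ _) (ℕ.≤-reflexive (count-update e D (fromℕ< i<M) (just g)))
    ...   | no  _   = ℕ.m≤m+n _ _

  occ≡0 : ∀ e x → ¬ MaybeAny.Any (e ~_) x → occ e x ≡ 0
  occ≡0 e x e≁x = cong (if_then 1 else 0) (dec-false (MaybeAny.dec (e ~?_) x) e≁x)

  occ≡1 : ∀ e x → MaybeAny.Any (e ~_) x → occ e x ≡ 1
  occ≡1 e x e~x = cong (if_then 1 else 0) (dec-true (MaybeAny.dec (e ~?_) x) e~x)

  occ*occ≡0 : ∀ {e f} → ¬ e ~ f → ∀ x → occ e x ℕ.* occ f x ≡ 0
  occ*occ≡0 {e} {f} e≁f x with MaybeAny.dec (e ~?_) x | MaybeAny.dec (f ~?_) x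
  ... | no  _          | _              = refl
  ... | yes _          | no _           = refl
  ... | yes (MaybeAny.just e~g) | yes (MaybeAny.just f~g) = contradiction (~-trans e~g (~-sym f~g)) e≁f

  module _ {t} (M≤t : M ℕ.≤ t) (g : Edge V) (D : Buffer) where
    open ≡-Reasoning

    private
      after : Edge V → Fin (suc t) → ℕ
      after e i = count e (step t g i D)

      lost : Edge V → Fin (suc t) → ℕ
      lost e = atSlot (occ e ∘ lookup D)

      Σ-lost : ∀ e → Σℕ (lost e) ≡ count e D
      Σ-lost e = Σ-atSlot (occ e ∘ lookup D) (ℕ.m≤n⇒m≤1+n M≤t)

      atSlot-0 : ∀ {n} {f : Fin M → ℕ} → (∀ u → f u ≡ 0) → (i : Fin n) → atSlot f i ≡ 0
      atSlot-0 f≡0 i with toℕ i ℕ.<? M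
      ... | yes i<M = f≡0 (fromℕ< i<M)
      ... | no  _   = refl

      drawn : Fin (suc t) → ℕ
      drawn = atSlot {M} λ _ → 1

      Σ-drawn : Σℕ drawn ≡ M
      Σ-drawn = trans (Σ-atSlot {M} (λ _ → 1) (ℕ.m≤n⇒m≤1+n M≤t)) (trans (Σℕ-const M 1) (ℕ.*-identityʳ M))

      drawn*atSlot : ∀ f i → drawn i ℕ.* atSlot {M} f i ≡ atSlot f i
      drawn*atSlot f i with toℕ i ℕ.<? M
      ... | yes i<M = ℕ.+-identityʳ _
      ... | no  _   = refl

      lost*lost : ∀ {e f} → ¬ e ~ f → ∀ i → lost e i ℕ.* lost f i ≡ 0
      lost*lost e≁f i with toℕ i ℕ.<? M
      ... | yes i<M = occ*occ≡0 e≁f (lookup D (fromℕ< i<M))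
      ... | no  _   = refl

      after-old : ∀ e → occ e (just g) ≡ 0 → ∀ i → after e i ℕ.+ lost e i ≡ count e D
      after-old e e≁g i = begin
        after e i ℕ.+ lost e i                               ≡⟨ count-step g i D M≤t e ⟩
        count e D ℕ.+ atSlot {M} (λ _ → occ e (just g)) i    ≡⟨ cong (count e D ℕ.+_) (atSlot-0 (λ _ → e≁g) i) ⟩
        count e D ℕ.+ 0                                      ≡⟨ ℕ.+-identityʳ _ ⟩
        count e D                                            ∎

      after-new : ∀ e → occ e (just g) ≡ 1 → count e D ≡ 0 → ∀ i → after e i ≡ drawn i
      after-new e e~g c≡0 i = begin
        after e i                                            ≡⟨ ℕ.+-identityʳ _ ⟨
        after e i ℕ.+ 0                                      ≡⟨ cong (after e i ℕ.+_) (atSlot-0 (unoccupied D c≡0) i) ⟨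
        after e i ℕ.+ lost e i                               ≡⟨ count-step g i D M≤t e ⟩
        count e D ℕ.+ atSlot {M} (λ _ → occ e (just g)) i    ≡⟨ cong₂ (λ c o → c ℕ.+ atSlot {M} (λ _ → o) i) c≡0 e~g ⟩
        drawn i                                              ∎
        where
        unoccupied : ∀ {m} (D : Vec (Maybe (Edge V)) m) → count e D ≡ 0 → ∀ u → occ e (lookup D u) ≡ 0
        unoccupied (x ∷ D) c≡0 zero    = ℕ.m+n≡0⇒m≡0 (occ e x) c≡0
        unoccupied (x ∷ D) c≡0 (suc u) = unoccupied D (ℕ.m+n≡0⇒n≡0 (occ e x) c≡0) u

    -- Each occurrence of `e` is evicted by exactly one of the `suc t` draws. On average the count
    -- is thus multiplied by t/(t + 1).
    Σ-count-old : ∀ e → occ e (just g) ≡ 0 →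
      Σℕ {suc t} (λ i → count e (step t g i D)) ℕ.+ count e D ≡ suc t ℕ.* count e D
    Σ-count-old e e≁g = begin
      Σℕ (after e) ℕ.+ count e D             ≡⟨ cong (Σℕ (after e) ℕ.+_) (Σ-lost e) ⟨
      Σℕ (after e) ℕ.+ Σℕ (lost e)           ≡⟨ Σℕ-+ (after e) (lost e) ⟨
      Σℕ (λ i → after e i ℕ.+ lost e i)      ≡⟨ Σℕ-cong (after-old e e≁g) ⟩
      Σℕ {suc t} (λ _ → count e D)           ≡⟨ Σℕ-const (suc t) (count e D) ⟩
      suc t ℕ.* count e D                    ∎

    Σ-count-new : ∀ e → occ e (just g) ≡ 1 → count e D ≡ 0 →
      Σℕ {suc t} (λ i → count e (step t g i D)) ≡ M
    Σ-count-new e e~g c≡0 = trans (Σℕ-cong (after-new e e~g c≡0)) Σ-drawn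

    -- If a draw evicts a occurrences of `e` and b of `f`, the product becomes (c - a)(d - b) = c d
    -- - d a - c b, as a b = 0. Over all draws a sums to c and b to d, so c d is lost twice: on
    -- average a factor (t - 1)/(t + 1).
    Σ-pair-old : ∀ e f → ¬ e ~ f → occ e (just g) ≡ 0 → occ f (just g) ≡ 0 →
      let c = count e D ; d = count f D in
      Σℕ {suc t} (λ i → count e (step t g i D) ℕ.* count f (step t g i D)) ℕ.+ (d ℕ.* c ℕ.+ c ℕ.* d)
        ≡ suc t ℕ.* (c ℕ.* d)
    Σ-pair-old e f e≁f e≁g f≁g = begin
      Σℕ both ℕ.+ (d ℕ.* c ℕ.+ c ℕ.* d)
        ≡⟨ cong (Σℕ both ℕ.+_) (cong₂ (λ x y → d ℕ.* x ℕ.+ c ℕ.* y) (Σ-lost e) (Σ-lost f)) ⟨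
      Σℕ both ℕ.+ (d ℕ.* Σℕ (lost e) ℕ.+ c ℕ.* Σℕ (lost f))
        ≡⟨ cong (Σℕ both ℕ.+_) (cong₂ ℕ._+_ (Σℕ-*ˡ d (lost e)) (Σℕ-*ˡ c (lost f))) ⟩
      Σℕ both ℕ.+ (Σℕ (λ i → d ℕ.* lost e i) ℕ.+ Σℕ (λ i → c ℕ.* lost f i))
        ≡⟨ cong (Σℕ both ℕ.+_) (Σℕ-+ (λ i → d ℕ.* lost e i) (λ i → c ℕ.* lost f i)) ⟨
      Σℕ both ℕ.+ Σℕ (λ i → d ℕ.* lost e i ℕ.+ c ℕ.* lost f i)
        ≡⟨ Σℕ-+ both (λ i → d ℕ.* lost e i ℕ.+ c ℕ.* lost f i) ⟨
      Σℕ (λ i → both i ℕ.+ (d ℕ.* lost e i ℕ.+ c ℕ.* lost f i))  ≡⟨ Σℕ-cong pointwise ⟩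
      Σℕ {suc t} (λ _ → c ℕ.* d)                                 ≡⟨ Σℕ-const (suc t) (c ℕ.* d) ⟩
      suc t ℕ.* (c ℕ.* d)                                        ∎
      where
      c = count e D
      d = count f D
      both : Fin (suc t) → ℕ
      both i = after e i ℕ.* after f i
      -- The expansion of (c - a)(d - b) without subtraction: c′ and d′ are the counts after the
      -- step, c′ + a and d′ + b those before it.
      expand : ∀ c′ d′ a b → c′ ℕ.* d′ ℕ.+ ((d′ ℕ.+ b) ℕ.* a ℕ.+ (c′ ℕ.+ a) ℕ.* b)
                           ≡ (c′ ℕ.+ a) ℕ.* (d′ ℕ.+ b) ℕ.+ a ℕ.* b
      expand = solve 4 (λ c′ d′ a b → c′ :* d′ :+ ((d′ :+ b) :* a :+ (c′ :+ a) :* b)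
                           := (c′ :+ a) :* (d′ :+ b) :+ a :* b) refl
        where open ℕ-Solver.+-*-Solver
      pointwise : ∀ i → both i ℕ.+ (d ℕ.* lost e i ℕ.+ c ℕ.* lost f i) ≡ c ℕ.* d
      pointwise i = begin
        both i ℕ.+ (d ℕ.* a ℕ.+ c ℕ.* b)
          ≡⟨ cong₂ (λ x y → both i ℕ.+ (y ℕ.* a ℕ.+ x ℕ.* b)) (after-old e e≁g i) (after-old f f≁g i) ⟨
        both i ℕ.+ ((after f i ℕ.+ b) ℕ.* a ℕ.+ (after e i ℕ.+ a) ℕ.* b)
          ≡⟨ expand (after e i) (after f i) a b ⟩
        (after e i ℕ.+ a) ℕ.* (after f i ℕ.+ b) ℕ.+ a ℕ.* b
          ≡⟨ cong₂ ℕ._+_ (cong₂ ℕ._*_ (after-old e e≁g i) (after-old f f≁g i)) (lost*lost e≁f i) ⟩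
        c ℕ.* d ℕ.+ 0   ≡⟨ ℕ.+-identityʳ _ ⟩
        c ℕ.* d         ∎
        where a = lost e i ; b = lost f i

    -- The new edge enters for `M` of the draws, and `f` can be evicted only by one of these. So for
    -- a single draw the product is `drawn i` times the old count of `f`, less `lost f i`; summing
    -- gives (M - 1) times that count.
    Σ-pair-new : ∀ e f → occ e (just g) ≡ 1 → count e D ≡ 0 → occ f (just g) ≡ 0 →
      Σℕ {suc t} (λ i → count e (step t g i D) ℕ.* count f (step t g i D)) ℕ.+ count f D ≡ M ℕ.* count f D
    Σ-pair-new e f e~g c≡0 f≁g = begin
      Σℕ both ℕ.+ d                        ≡⟨ cong (Σℕ both ℕ.+_) (Σ-lost f) ⟨
      Σℕ both ℕ.+ Σℕ (lost f)              ≡⟨ Σℕ-+ both (lost f) ⟨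
      Σℕ (λ i → both i ℕ.+ lost f i)       ≡⟨ Σℕ-cong pointwise ⟩
      Σℕ (λ i → d ℕ.* drawn i)             ≡⟨ Σℕ-*ˡ d drawn ⟨
      d ℕ.* Σℕ drawn                       ≡⟨ cong (d ℕ.*_) Σ-drawn ⟩
      d ℕ.* M                              ≡⟨ ℕ.*-comm d M ⟩
      M ℕ.* d                              ∎
      where
      d = count f D
      both : Fin (suc t) → ℕ
      both i = after e i ℕ.* after f i
      pointwise : ∀ i → both i ℕ.+ lost f i ≡ d ℕ.* drawn i
      pointwise i = begin
        both i ℕ.+ lost f i
          ≡⟨ cong₂ ℕ._+_ (cong (ℕ._* after f i) (after-new e e~g c≡0 i)) (sym (drawn*atSlot (occ f ∘ lookup D) i)) ⟩
        drawn i ℕ.* after f i ℕ.+ drawn i ℕ.* lost f i   ≡⟨ ℕ.*-distribˡ-+ (drawn i) _ _ ⟨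
        drawn i ℕ.* (after f i ℕ.+ lost f i)             ≡⟨ cong (drawn i ℕ.*_) (after-old f f≁g i) ⟩
        drawn i ℕ.* d                                    ≡⟨ ℕ.*-comm (drawn i) d ⟩
        d ℕ.* drawn i                                    ∎

-- The buffer along the whole stream.

module Stream {v} {V : Set v} (_≟_ : DecidableEquality V) (M : ℕ) {N} (S : GraphStream V N) where
  open Reservoir _≟_ M
  open Occurrences _≟_ M
  open GraphStream S

  edge-injective : ∀ {i j} → edge i ~ edge j → i ≡ j
  edge-injective {i} {j} i~j with i Fin.≟ j
  ... | yes i≡j = i≡j
  ... | no  i≢j = contradiction i~j (distinct i j i≢j)

  -- The slot about to be filled is still empty, so nothing is evicted while the buffer fills up;
  -- `count-filling` rests on this.
  lookup-vacant : ∀ {t} (t≤N : t ℕ.≤ N) → t ℕ.≤ M → ∀ ω (u : Fin M) → t ℕ.≤ toℕ u →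
                  lookup (buffer S t≤N ω) u ≡ nothing
  lookup-vacant {zero}  _   _   _       u _   = Vec.lookup-replicate u nothing
  lookup-vacant {suc t} t<N t<M (ω , i) u t<u = begin
    lookup (step t g i D) u                  ≡⟨ cong (λ D′ → lookup D′ u) (step-fill g i D t<M) ⟩
    lookup (D [ fromℕ< t<M ]≔ just g) u      ≡⟨ Vec.lookup∘update′ u≢t D (just g) ⟩
    lookup D u                               ≡⟨ lookup-vacant (ℕ.<⇒≤ t<N) (ℕ.<⇒≤ t<M) ω u (ℕ.<⇒≤ t<u) ⟩
    nothing                                  ∎
    where
    open ≡-Reasoning
    g = edge (fromℕ< t<N)
    D = buffer S (ℕ.<⇒≤ t<N) ω
    u≢t : u ≢ fromℕ< t<M
    u≢t u≡t = ℕ.<⇒≢ t<u (sym (trans (cong toℕ u≡t) (Fin.toℕ-fromℕ< t<M)))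

  module Tracked (e : Edge V) (k : Fin N) (k~e : edge k ~ e) where

    -- Pairs the time comparison with the value of `occ` at the arriving edge, so that one case
    -- split supplies both.
    data Arrival {t} (t<N : t ℕ.< N) : Set where
      now   : toℕ k ≡ t → occ e (just (edge (fromℕ< t<N))) ≡ 1 → Arrival t<N
      other : toℕ k ≢ t → occ e (just (edge (fromℕ< t<N))) ≡ 0 → Arrival t<N

    arrival : ∀ {t} (t<N : t ℕ.< N) → Arrival t<N
    arrival {t} t<N with toℕ k ℕ.≟ t
    ... | yes k≡t = now k≡t (occ≡1 e (just _) (MaybeAny.just (~-sym (subst (λ j → edge j ~ e)
                      (Fin.toℕ-injective (trans k≡t (sym (Fin.toℕ-fromℕ< t<N)))) k~e))))
    -- Distinctness of the stream enters here: an arriving edge equivalent to `e` would have index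
    -- `k`.
    ... | no  k≢t = other k≢t (occ≡0 e (just _) λ where
                      (MaybeAny.just e~j) → k≢t (trans (cong toℕ (edge-injective (~-trans k~e e~j)))
                                                       (Fin.toℕ-fromℕ< t<N)))

    count-before : ∀ {t} (t≤N : t ℕ.≤ N) → t ℕ.≤ toℕ k → ∀ ω → count e (buffer S t≤N ω) ≡ 0
    count-before {zero}  _   _   _       = count-replicate e M
    count-before {suc t} t<N t<k (ω , i) with arrival t<N
    ... | now   k≡t _   = contradiction (sym k≡t) (ℕ.<⇒≢ t<k)
    ... | other _   e≁g = ℕ.n≤0⇒n≡0 (ℕ.≤-trans (count-step-≤ _ i (buffer S (ℕ.<⇒≤ t<N) ω) e)
      (ℕ.≤-reflexive (cong₂ ℕ._+_ (count-before (ℕ.<⇒≤ t<N) (ℕ.<⇒≤ t<k) ω) e≁g)))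

    -- Before its arrival `e` is absent, the arrival brings at most one occurrence, and no later
    -- edge brings another.
    count≤1 : ∀ {t} (t≤N : t ℕ.≤ N) ω → count e (buffer S t≤N ω) ℕ.≤ 1
    count≤1 {zero}  _   _       = ℕ.≤-trans (ℕ.≤-reflexive (count-replicate e M)) z≤n
    count≤1 {suc t} t<N (ω , i) with arrival t<N
    ... | now k≡t e~g = ℕ.≤-trans (count-step-≤ _ i (buffer S (ℕ.<⇒≤ t<N) ω) e)
      (ℕ.≤-reflexive (cong₂ ℕ._+_ (count-before (ℕ.<⇒≤ t<N) (ℕ.≤-reflexive (sym k≡t)) ω) e~g))
    ... | other _ e≁g = ℕ.≤-trans (count-step-≤ _ i (buffer S (ℕ.<⇒≤ t<N) ω) e)
      (ℕ.≤-trans (ℕ.≤-reflexive (trans (cong (count e (buffer S (ℕ.<⇒≤ t<N) ω) ℕ.+_) e≁g) (ℕ.+-identityʳ _))) (count≤1 (ℕ.<⇒≤ t<N) ω))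

    count-filling : ∀ {t} (t≤N : t ℕ.≤ N) → toℕ k ℕ.< t → t ℕ.≤ M → ∀ ω → count e (buffer S t≤N ω) ≡ 1
    count-filling {suc t} t<N (s≤s k≤t) t<M (ω , i) = begin
      count e (step t g i D)                          ≡⟨ cong (count e) (step-fill g i D t<M) ⟩
      count e D′                                      ≡⟨ ℕ.+-identityʳ _ ⟨
      count e D′ ℕ.+ 0                                ≡⟨ cong (λ x → count e D′ ℕ.+ occ e x) vacant ⟨
      count e D′ ℕ.+ occ e (lookup D (fromℕ< t<M))    ≡⟨ count-update e D (fromℕ< t<M) (just g) ⟩
      count e D ℕ.+ occ e (just g)                    ≡⟨ new (arrival t<N) ⟩
      1                                               ∎
      where
      open ≡-Reasoning
      g = edge (fromℕ< t<N)
      D = buffer S (ℕ.<⇒≤ t<N) ω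
      D′ = D [ fromℕ< t<M ]≔ just g
      vacant : lookup D (fromℕ< t<M) ≡ nothing
      vacant = lookup-vacant (ℕ.<⇒≤ t<N) (ℕ.<⇒≤ t<M) ω _ (ℕ.≤-reflexive (sym (Fin.toℕ-fromℕ< t<M)))
      new : Arrival t<N → count e D ℕ.+ occ e (just g) ≡ 1
      new (now   k≡t e~g) = cong₂ ℕ._+_ (count-before (ℕ.<⇒≤ t<N) (ℕ.≤-reflexive (sym k≡t)) ω) e~g
      new (other k≢t e≁g) =
        cong₂ ℕ._+_ (count-filling (ℕ.<⇒≤ t<N) (ℕ.≤∧≢⇒< k≤t k≢t) (ℕ.<⇒≤ t<M) ω) e≁g

-- Inclusion probabilities of one edge and of two edges.

module Inclusion {k ℓ₁ ℓ₂} (K : OrderedField k ℓ₁ ℓ₂) {v} {V : Set v} (_≟_ : DecidableEquality V)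
                 (M : ℕ) {N} (S : GraphStream V N) where
  open OrderedField K
  open Probability K
  open OrderedFieldProperties K renaming (refl to ≈-refl; sym to ≈-sym; trans to ≈-trans; reflexive to ≈-reflexive)
  open Expectation K
  open Reservoir _≟_ M
  open Occurrences _≟_ M
  open Stream _≟_ M S
  open GraphStream S
  open ≤-Reasoning
  open import Algebra.Properties.Semiring.Mult semiring using (×-homo-+; ×1-homo-*)

  fromℕ-+ : ∀ m n → fromℕ (m ℕ.+ n) ≈ fromℕ m + fromℕ n
  fromℕ-+ = ×-homo-+ 1#

  fromℕ-* : ∀ m n → fromℕ (m ℕ.* n) ≈ fromℕ m * fromℕ n
  fromℕ-* = ×1-homo-*

  fromℕ-Σ : ∀ {n} (f : Fin n → ℕ) → fromℕ (Σℕ f) ≈ sum (fromℕ ∘ f)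
  fromℕ-Σ {zero}  f = ≈-refl
  fromℕ-Σ {suc n} f = ≈-trans (fromℕ-+ (f zero) _) (+-congˡ (fromℕ-Σ (f ∘ suc)))

  𝔼ℕ : ∀ {T} → (Draws T → ℕ) → Carrier
  𝔼ℕ Z = 𝔼 (fromℕ ∘ Z)

  𝔼ℕ-cong : ∀ {T} {Z W : Draws T → ℕ} → (∀ ω → Z ω ≡ W ω) → 𝔼ℕ Z ≈ 𝔼ℕ W
  𝔼ℕ-cong Z≡W = 𝔼-cong λ ω → ≈-reflexive (cong fromℕ (Z≡W ω))

  𝔼ℕ-+ : ∀ {T} (Z W : Draws T → ℕ) → 𝔼ℕ (λ ω → Z ω ℕ.+ W ω) ≈ 𝔼ℕ Z + 𝔼ℕ W
  𝔼ℕ-+ Z W = ≈-trans (𝔼-cong λ ω → fromℕ-+ (Z ω) (W ω)) (𝔼-+ (fromℕ ∘ Z) (fromℕ ∘ W))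

  𝔼ℕ-*ˡ : ∀ {T} n (Z : Draws T → ℕ) → 𝔼ℕ (λ ω → n ℕ.* Z ω) ≈ fromℕ n * 𝔼ℕ Z
  𝔼ℕ-*ˡ n Z = ≈-trans (𝔼-cong λ ω → fromℕ-* n (Z ω)) (𝔼-*ˡ (fromℕ n) (fromℕ ∘ Z))

  𝔼ℕ-const : ∀ {T} n {Z : Draws T → ℕ} → (∀ ω → Z ω ≡ n) → 𝔼ℕ Z ≈ fromℕ n
  𝔼ℕ-const {T} n Z≡n = ≈-trans (𝔼ℕ-cong Z≡n) (𝔼-const {T} (fromℕ n))

  𝔼ℕ-step : ∀ {T} (Z : Draws (suc T) → ℕ) →
            𝔼ℕ Z * fromℕ (suc T) ≈ 𝔼ℕ (λ ω → Σℕ λ i → Z (ω , i))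
  𝔼ℕ-step {T} Z = ≈-trans (𝔼-step (fromℕ ∘ Z)) (𝔼-cong {T} λ ω → ≈-sym (fromℕ-Σ λ i → Z (ω , i)))

  private
    M≡1+t : ∀ {t} → M ℕ.≤ suc t → ¬ M ℕ.≤ t → M ≡ suc t
    M≡1+t M≤1+t M≰t = ℕ.≤-antisym M≤1+t (ℕ.≰⇒> M≰t)

    cancel-+ : ∀ {x y z} → x + y ≈ z → x ≈ z - y
    cancel-+ {x} {y} {z} x+y≈z = ≈-trans
      (solve 2 (λ x y → x := (x :+ y) :- y) ≈-refl x y) (+-congʳ x+y≈z)

  module _ (e : Edge V) (k : Fin N) (k~e : edge k ~ e) where
    open Tracked e k k~e

    -- The factor t/(t + 1) of `Σ-count-old` keeps the left side constant. The induction starts when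
    -- the buffer becomes full or when the edge arrives, whichever is later; in the latter case the
    -- edge is stored by `M` of the draws.
    𝔼-count : ∀ {t} (t≤N : t ℕ.≤ N) → M ℕ.≤ t → toℕ k ℕ.< t →
              𝔼ℕ (λ ω → count e (buffer S t≤N ω)) * fromℕ t ≈ fromℕ M
    𝔼-count {suc t} t<N M≤1+t (s≤s k≤t) with M ℕ.≤? t
    -- Here `M` equals `suc t`: the buffer has just become full and holds the edge with certainty.
    ... | no M≰t = begin-equality
      𝔼ℕ {suc t} (λ ω → count e (buffer S t<N ω)) * fromℕ (suc t)
        ≈⟨ *-congʳ (𝔼ℕ-const {suc t} 1 (count-filling t<N (s≤s k≤t) (ℕ.≰⇒> M≰t))) ⟩
      (1# + 0#) * fromℕ (suc t)   ≈⟨ *-congʳ (+-identityʳ 1#) ⟩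
      1# * fromℕ (suc t)          ≈⟨ *-identityˡ _ ⟩
      fromℕ (suc t)               ≈⟨ ≈-reflexive (cong fromℕ (M≡1+t M≤1+t M≰t)) ⟨
      fromℕ M                     ∎
    ... | yes M≤t with arrival t<N
    ...   | now k≡t e~g = begin-equality
      𝔼ℕ (λ ω → count e (buffer S t<N ω)) * fromℕ (suc t)
        ≈⟨ 𝔼ℕ-step (λ ω → count e (buffer S t<N ω)) ⟩
      𝔼ℕ {t} (λ ω → Σℕ λ i → count e (buffer S t<N (ω , i)))
        ≈⟨ 𝔼ℕ-const {t} M (λ ω → Σ-count-new M≤t _ _ e e~g
             (count-before (ℕ.<⇒≤ t<N) (ℕ.≤-reflexive (sym k≡t)) ω)) ⟩
      fromℕ M                     ∎
    ...   | other k≢t e≁g = begin-equality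
      E′ * fromℕ (suc t)          ≈⟨ cancel-+ recurrence ⟩
      (1# + fromℕ t) * E - E      ≈⟨ solve 2 (λ s E → (con (+ 1) :+ s) :* E :- E := E :* s) ≈-refl (fromℕ t) E ⟩
      E * fromℕ t                 ≈⟨ 𝔼-count (ℕ.<⇒≤ t<N) M≤t (ℕ.≤∧≢⇒< k≤t k≢t) ⟩
      fromℕ M                     ∎
      where
      C : Draws t → ℕ
      C ω = count e (buffer S (ℕ.<⇒≤ t<N) ω)
      C′ : Draws (suc t) → ℕ
      C′ ω = count e (buffer S t<N ω)
      E = 𝔼ℕ C
      E′ = 𝔼ℕ C′
      recurrence : E′ * fromℕ (suc t) + E ≈ fromℕ (suc t) * E
      recurrence = begin-equality
        E′ * fromℕ (suc t) + E                         ≈⟨ +-congʳ (𝔼ℕ-step C′) ⟩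
        𝔼ℕ (λ ω → Σℕ λ i → C′ (ω , i)) + E             ≈⟨ 𝔼ℕ-+ (λ ω → Σℕ λ i → C′ (ω , i)) C ⟨
        𝔼ℕ (λ ω → Σℕ (λ i → C′ (ω , i)) ℕ.+ C ω)       ≈⟨ 𝔼ℕ-cong {t} (λ ω → Σ-count-old M≤t _ _ e e≁g) ⟩
        𝔼ℕ (λ ω → suc t ℕ.* C ω)                       ≈⟨ 𝔼ℕ-*ˡ (suc t) C ⟩
        fromℕ (suc t) * E                              ∎

  module _ {t} (t<N : t ℕ.< N) (M≤t : M ℕ.≤ t) (e f : Edge V) where

    private
      C D P : Draws t → ℕ
      C ω = count e (buffer S (ℕ.<⇒≤ t<N) ω)
      D ω = count f (buffer S (ℕ.<⇒≤ t<N) ω)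
      P ω = C ω ℕ.* D ω
      P′ : Draws (suc t) → ℕ
      P′ ω = count e (buffer S t<N ω) ℕ.* count f (buffer S t<N ω)
      s m : Carrier
      s = fromℕ t
      m = fromℕ M

    -- One step gives (t + 1) E′ = (t - 1) E; multiplying by t makes the two sides instances of the
    -- same expression at t + 1 and at t.
    𝔼-pair-old : ¬ e ~ f → occ e (just (edge (fromℕ< t<N))) ≡ 0 → occ f (just (edge (fromℕ< t<N))) ≡ 0 →
      𝔼ℕ P′ * (fromℕ (suc t) * (fromℕ (suc t) - 1#)) ≈ 𝔼ℕ P * (s * (s - 1#))
    𝔼-pair-old e≁f e≁g f≁g = begin-equality
      𝔼ℕ P′ * (fromℕ (suc t) * (fromℕ (suc t) - 1#))
        ≈⟨ solve 2 (λ x s → x :* ((con (+ 1) :+ s) :* ((con (+ 1) :+ s) :- con (+ 1)))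
                         := (x :* (con (+ 1) :+ s)) :* s) ≈-refl (𝔼ℕ P′) s ⟩
      (𝔼ℕ P′ * fromℕ (suc t)) * s                          ≈⟨ *-congʳ (cancel-+ recurrence) ⟩
      (fromℕ (suc t) * 𝔼ℕ P - (𝔼ℕ P + 𝔼ℕ P)) * s
        ≈⟨ solve 2 (λ x s → ((con (+ 1) :+ s) :* x :- (x :+ x)) :* s := x :* (s :* (s :- con (+ 1))))
             ≈-refl (𝔼ℕ P) s ⟩
      𝔼ℕ P * (s * (s - 1#))                                ∎
      where
      Q : Draws t → ℕ
      Q ω = D ω ℕ.* C ω
      recurrence : 𝔼ℕ P′ * fromℕ (suc t) + (𝔼ℕ P + 𝔼ℕ P) ≈ fromℕ (suc t) * 𝔼ℕ P
      recurrence = begin-equality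
        𝔼ℕ P′ * fromℕ (suc t) + (𝔼ℕ P + 𝔼ℕ P)
          ≈⟨ +-cong (𝔼ℕ-step P′) (+-congʳ (𝔼ℕ-cong {t} λ ω → ℕ.*-comm (C ω) (D ω))) ⟩
        𝔼ℕ (λ ω → Σℕ λ i → P′ (ω , i)) + (𝔼ℕ Q + 𝔼ℕ P)               ≈⟨ +-congˡ (𝔼ℕ-+ Q P) ⟨
        𝔼ℕ (λ ω → Σℕ λ i → P′ (ω , i)) + 𝔼ℕ (λ ω → Q ω ℕ.+ P ω)
          ≈⟨ 𝔼ℕ-+ (λ ω → Σℕ λ i → P′ (ω , i)) (λ ω → Q ω ℕ.+ P ω) ⟨
        𝔼ℕ (λ ω → Σℕ (λ i → P′ (ω , i)) ℕ.+ (Q ω ℕ.+ P ω))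
          ≈⟨ 𝔼ℕ-cong {t} (λ ω → Σ-pair-old M≤t _ _ e f e≁f e≁g f≁g) ⟩
        𝔼ℕ (λ ω → suc t ℕ.* P ω)                                      ≈⟨ 𝔼ℕ-*ˡ (suc t) P ⟩
        fromℕ (suc t) * 𝔼ℕ P                                          ∎

    -- The base case at the arrival of the later edge: one step gives (t + 1) E′ = (M - 1) 𝔼 D, and
    -- multiplying by t brings in the known mean of the earlier edge.
    𝔼-pair-new : occ e (just (edge (fromℕ< t<N))) ≡ 1 → (∀ ω → C ω ≡ 0) →
      occ f (just (edge (fromℕ< t<N))) ≡ 0 → 𝔼ℕ D * s ≈ m →
      𝔼ℕ P′ * (fromℕ (suc t) * (fromℕ (suc t) - 1#)) ≈ m * (m - 1#)
    𝔼-pair-new e~g C≡0 f≁g 𝔼D*s≈m = begin-equality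
      𝔼ℕ P′ * (fromℕ (suc t) * (fromℕ (suc t) - 1#))
        ≈⟨ solve 2 (λ x s → x :* ((con (+ 1) :+ s) :* ((con (+ 1) :+ s) :- con (+ 1)))
                         := (x :* (con (+ 1) :+ s)) :* s) ≈-refl (𝔼ℕ P′) s ⟩
      (𝔼ℕ P′ * fromℕ (suc t)) * s     ≈⟨ *-congʳ (cancel-+ recurrence) ⟩
      (m * 𝔼ℕ D - 𝔼ℕ D) * s
        ≈⟨ solve 3 (λ m d s → (m :* d :- d) :* s := (d :* s) :* (m :- con (+ 1))) ≈-refl m (𝔼ℕ D) s ⟩
      (𝔼ℕ D * s) * (m - 1#)           ≈⟨ *-congʳ 𝔼D*s≈m ⟩
      m * (m - 1#)                    ∎
      where
      recurrence : 𝔼ℕ P′ * fromℕ (suc t) + 𝔼ℕ D ≈ m * 𝔼ℕ D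
      recurrence = begin-equality
        𝔼ℕ P′ * fromℕ (suc t) + 𝔼ℕ D               ≈⟨ +-congʳ (𝔼ℕ-step P′) ⟩
        𝔼ℕ (λ ω → Σℕ λ i → P′ (ω , i)) + 𝔼ℕ D      ≈⟨ 𝔼ℕ-+ (λ ω → Σℕ λ i → P′ (ω , i)) D ⟨
        𝔼ℕ (λ ω → Σℕ (λ i → P′ (ω , i)) ℕ.+ D ω)
          ≈⟨ 𝔼ℕ-cong {t} (λ ω → Σ-pair-new M≤t _ _ e f e~g (C≡0 ω) f≁g) ⟩
        𝔼ℕ (λ ω → M ℕ.* D ω)                       ≈⟨ 𝔼ℕ-*ˡ M D ⟩
        m * 𝔼ℕ D                                   ∎

  module _ (e f : Edge V) (k l : Fin N) (k~e : edge k ~ e) (l~f : edge l ~ f) (e≁f : ¬ e ~ f) where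
    private
      module E = Tracked e k k~e
      module F = Tracked f l l~f

      m : Carrier
      m = fromℕ M

      k≢l : toℕ k ≢ toℕ l
      k≢l k≡l = e≁f (~-trans (~-sym k~e) (subst (λ j → edge j ~ f) (sym (Fin.toℕ-injective k≡l)) l~f))

    𝔼-pair : ∀ {t} (t≤N : t ℕ.≤ N) → M ℕ.≤ t → toℕ k ℕ.< t → toℕ l ℕ.< t →
      𝔼ℕ (λ ω → count e (buffer S t≤N ω) ℕ.* count f (buffer S t≤N ω)) * (fromℕ t * (fromℕ t - 1#))
        ≈ m * (m - 1#)
    𝔼-pair {suc t} t<N M≤1+t (s≤s k≤t) (s≤s l≤t) with M ℕ.≤? t
    ... | no M≰t = begin-equality
      𝔼ℕ {suc t} (λ ω → count e (buffer S t<N ω) ℕ.* count f (buffer S t<N ω)) * (n * (n - 1#))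
        ≈⟨ *-congʳ (𝔼ℕ-const {suc t} 1 λ ω → cong₂ ℕ._*_ (E.count-filling t<N (s≤s k≤t) t<M ω)
                                                          (F.count-filling t<N (s≤s l≤t) t<M ω)) ⟩
      (1# + 0#) * (n * (n - 1#))   ≈⟨ *-congʳ (+-identityʳ 1#) ⟩
      1# * (n * (n - 1#))          ≈⟨ *-identityˡ _ ⟩
      n * (n - 1#)                 ≈⟨ ≈-reflexive (cong (λ l → fromℕ l * (fromℕ l - 1#)) (M≡1+t M≤1+t M≰t)) ⟨
      m * (m - 1#)                 ∎
      where
      n = fromℕ (suc t)
      t<M = ℕ.≰⇒> M≰t
    ... | yes M≤t with E.arrival t<N | F.arrival t<N
    ...   | E.now k≡t _ | F.now l≡t _ = contradiction (trans k≡t (sym l≡t)) k≢l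
    ...   | E.now k≡t e~g | F.other l≢t f≁g = 𝔼-pair-new t<N M≤t e f e~g
      (E.count-before (ℕ.<⇒≤ t<N) (ℕ.≤-reflexive (sym k≡t))) f≁g
      (𝔼-count f l l~f (ℕ.<⇒≤ t<N) M≤t (ℕ.≤∧≢⇒< l≤t l≢t))
    ...   | E.other k≢t e≁g | F.now l≡t f~g = ≈-trans
      (*-congʳ (𝔼ℕ-cong {suc t} λ ω → ℕ.*-comm (count e (buffer S t<N ω)) (count f (buffer S t<N ω))))
      (𝔼-pair-new t<N M≤t f e f~g (F.count-before (ℕ.<⇒≤ t<N) (ℕ.≤-reflexive (sym l≡t))) e≁g
        (𝔼-count e k k~e (ℕ.<⇒≤ t<N) M≤t (ℕ.≤∧≢⇒< k≤t k≢t)))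
    ...   | E.other k≢t e≁g | F.other l≢t f≁g = ≈-trans
      (𝔼-pair-old t<N M≤t e f e≁f e≁g f≁g)
      (𝔼-pair (ℕ.<⇒≤ t<N) M≤t (ℕ.≤∧≢⇒< k≤t k≢t) (ℕ.≤∧≢⇒< l≤t l≢t))

-- The smoothing recursion over buckets.

module Smoothing {k ℓ₁ ℓ₂} (K : OrderedField k ℓ₁ ℓ₂) {v} {V : Set v} (_≟_ : DecidableEquality V)
                 {N} (S : GraphStream V N) (M J : ℕ) .{{_ : NonZero J}} where
  open OrderedField K
  open OrderedFieldProperties K renaming (refl to ≈-refl; sym to ≈-sym; trans to ≈-trans; reflexive to ≈-reflexive)
  open FURL K _≟_ S M
  open ≤-Reasoning

  module _ (δ : Carrier) where

    -- Smoothing is linear, so a random factor `z` common to all times comes out and leaves a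
    -- coefficient depending on the deterministic profile `h` alone.
    smooth-* : ∀ {x h : ℕ → Carrier} {z} → (∀ t → x t ≈ h t * z) → ∀ i t → smooth J δ x i t ≈ smooth J δ h i t * z
    smooth-* x≈hz zero t = x≈hz t
    smooth-* {x} {h} {z} x≈hz (suc i) t = begin-equality
      δ * smooth J δ x i t′ + (1# - δ) * x t
        ≈⟨ +-cong (*-congˡ (smooth-* x≈hz i t′)) (*-congˡ (x≈hz t)) ⟩
      δ * (smooth J δ h i t′ * z) + (1# - δ) * (h t * z)
        ≈⟨ solve 4 (λ δ s h z → δ :* (s :* z) :+ (con (+ 1) :- δ) :* (h :* z)
                             := (δ :* s :+ (con (+ 1) :- δ) :* h) :* z) ≈-refl δ (smooth J δ h i t′) (h t) z ⟩
      (δ * smooth J δ h i t′ + (1# - δ) * h t) * z  ∎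
      where t′ = T-M J δ ℕ.+ i ℕ.* J

    bucket-positive : ∀ {t} → suc M ℕ.< t → bucket J δ t ≡ suc ((t ℕ.∸ suc (suc M)) ℕ./ J)
    bucket-positive {t} 1+M<t =
      cong (if_then 0 else suc ((t ℕ.∸ suc (suc M)) ℕ./ J)) (dec-false (t ℕ.≤? suc M) (ℕ.<⇒≱ 1+M<t))

    module _ (0≤δ : 0# ≤ δ) (δ<1 : δ < 1#) where

      private
        1-δ≥0 : 0# ≤ 1# - δ
        1-δ≥0 = inj₁ (x<y⇒0<y-x δ<1)

        1-mix : ∀ s y → δ * (1# - s) + (1# - δ) * (1# - y) ≈ 1# - (δ * s + (1# - δ) * y)
        1-mix s y = solve 3 (λ δ s y → δ :* (con (+ 1) :- s) :+ (con (+ 1) :- δ) :* (con (+ 1) :- y)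
                                   := con (+ 1) :- (δ :* s :+ (con (+ 1) :- δ) :* y)) ≈-refl δ s y

      module _ {h : ℕ → Carrier} (0≤h : ∀ t → 0# ≤ h t) (h≤1 : ∀ t → h t ≤ 1#) where

        smooth-nonneg : ∀ i t → 0# ≤ smooth J δ h i t
        smooth-nonneg zero    t = 0≤h t
        smooth-nonneg (suc i) t = +-nonneg (*-nonneg 0≤δ (smooth-nonneg i _)) (*-nonneg 1-δ≥0 (0≤h t))

        smooth-≤1 : ∀ i t → smooth J δ h i t ≤ 1#
        smooth-≤1 zero    t = h≤1 t
        smooth-≤1 (suc i) t =
          ≤-by (+-nonneg (*-nonneg 0≤δ (x≤y⇒0≤y-x (smooth-≤1 i _))) (*-nonneg 1-δ≥0 (x≤y⇒0≤y-x (h≤1 t))))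
            (1-mix (smooth J δ h i (T-M J δ ℕ.+ i ℕ.* J)) (h t))

        -- The current term alone contributes 1 - δ; the inherited term δ s is not negative.
        smooth-≥1-δ : ∀ i {t} → h t ≈ 1# → 1# - δ ≤ smooth J δ h (suc i) t
        smooth-≥1-δ i {t} h≈1 = ≤-by (*-nonneg 0≤δ (smooth-nonneg i _)) (begin-equality
          δ * s                                      ≈⟨ solve 2 (λ δ s → δ :* s := (δ :* s :+ (con (+ 1) :- δ) :* con (+ 1)) :- (con (+ 1) :- δ)) ≈-refl δ s ⟩
          (δ * s + (1# - δ) * 1#) - (1# - δ)         ≈⟨ +-congʳ (+-congˡ (*-congˡ h≈1)) ⟨
          (δ * s + (1# - δ) * h t) - (1# - δ)        ∎)
          where s = smooth J δ h i (T-M J δ ℕ.+ i ℕ.* J)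

        module _ (0<δ : 0# < δ) (h[T-M]≈0 : h (T-M J δ) ≈ 0#) where

          smooth-step-<1 : ∀ i t → smooth J δ h i (T-M J δ ℕ.+ i ℕ.* J) < 1# → smooth J δ h (suc i) t < 1#
          smooth-step-<1 i t s<1 =
            <-by (+-pos (*-pos 0<δ (x<y⇒0<y-x s<1)) (*-nonneg 1-δ≥0 (x≤y⇒0≤y-x (h≤1 t))))
              (1-mix (smooth J δ h i (T-M J δ ℕ.+ i ℕ.* J)) (h t))

          -- The recursion goes back through the ends of the earlier buckets to `T-M`, where `h` is
          -- 0. There the shortfall from 1 is 1, and each bucket keeps at least the fraction δ of
          -- it, so at the end of bucket i it is at least δ^i.
          smooth-end-<1 : ∀ i → smooth J δ h i (T-M J δ ℕ.+ i ℕ.* J) < 1#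
          smooth-end-<1 zero = begin-strict
            h (T-M J δ ℕ.+ 0)  ≈⟨ ≈-reflexive (cong h (ℕ.+-identityʳ _)) ⟩
            h (T-M J δ)        ≈⟨ h[T-M]≈0 ⟩
            0#                 <⟨ 0<1 ⟩
            1#                 ∎
          smooth-end-<1 (suc i) = smooth-step-<1 i _ (smooth-end-<1 i)

          smooth-<1 : ∀ i t → smooth J δ h (suc i) t < 1#
          smooth-<1 i t = smooth-step-<1 i t (smooth-end-<1 i)

-- The triangle: probability of being counted, and the comparison.

module _ {k ℓ₁ ℓ₂} (K : OrderedField k ℓ₁ ℓ₂) {v} {V : Set v} (_≟_ : DecidableEquality V)
         {N} (S : GraphStream V N) (M : ℕ) (2≤M : 2 ℕ.≤ M) (Δ : Triangle S) where
  open OrderedField K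
  open Probability K
  open OrderedFieldProperties K renaming (refl to ≈-refl; sym to ≈-sym; trans to ≈-trans; reflexive to ≈-reflexive)
  open Expectation K
  open FURL K _≟_ S M
  open Reservoir _≟_ M
  open Occurrences _≟_ M
  open Stream _≟_ M S
  open Inclusion K _≟_ M S
  open GraphStream S
  open Triangle Δ
  open ≤-Reasoning

  -- The two ways of being equivalent force a = b = c or a = c, making the edge `ab` or the edge
  -- `ca` a loop.
  ab≁bc : ¬ (a , b) ~ (b , c)
  ab≁bc (inj₁ (refl , refl)) with edge-ab
  ... | inj₁ (p , q) = loopless ab (trans p (sym q))
  ... | inj₂ (p , q) = loopless ab (trans p (sym q))
  ab≁bc (inj₂ (refl , _)) with edge-ca
  ... | inj₁ (p , q) = loopless ca (trans p (sym q))
  ... | inj₂ (p , q) = loopless ca (trans p (sym q))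

  𝔼-counted : M ℕ.≤ toℕ ca → 𝔼 (λ ω → ⟦ does (counted? Δ ω) ⟧) * q formationTime ≈ 1#
  𝔼-counted M≤t = begin-equality
    𝔼 (λ ω → ⟦ does (counted? Δ ω) ⟧) * q formationTime       ≈⟨ *-congʳ (𝔼-cong counted≈) ⟨
    E * (((fromℕ formationTime - 1#) * (fromℕ formationTime - 2#)) / (m * (m - 1#)))
      -- Counting precedes the sampling step, so s = Tλ - 1 edges have been processed, and the
      -- numerator of `q` is the s (s - 1) of `𝔼-pair`.
      ≈⟨ solve 3 (λ E s d → E :* ((((con (+ 1) :+ s) :- con (+ 1)) :* ((con (+ 1) :+ s) :- con (+ 2))) :* d)
                         := (E :* (s :* (s :- con (+ 1)))) :* d)
           ≈-refl E (fromℕ (toℕ ca)) ((m * (m - 1#)) ⁻¹) ⟩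
    (E * (fromℕ (toℕ ca) * (fromℕ (toℕ ca) - 1#))) / (m * (m - 1#))
      ≈⟨ *-congʳ (𝔼-pair (a , b) (b , c) ab bc edge-ab edge-bc ab≁bc t≤N M≤t ab<ca bc<ca) ⟩
    (m * (m - 1#)) / (m * (m - 1#))
      ≈⟨ *-inverseʳ _ (0<x⇒x≉0 (0<m[m-1] 2≤M)) ⟩
    1#                                                        ∎
    where
    m = fromℕ M
    t≤N = ℕ.<⇒≤ (Fin.toℕ<n ca)
    E = 𝔼ℕ λ ω → count (a , b) (buffer S t≤N ω) ℕ.* count (b , c) (buffer S t≤N ω)

    -- The bound `2 ℕ.≤ M` makes the denominator of `q` positive, hence invertible.
    0<m[m-1] : ∀ {n} → 2 ℕ.≤ n → 0# < fromℕ n * (fromℕ n - 1#)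
    0<m[m-1] {suc (suc n)} (s≤s (s≤s _)) = *-pos (fromℕ-pos (suc n))
      (<-respʳ-≈ (solve 1 (λ x → x := (con (+ 1) :+ x) :- con (+ 1)) ≈-refl (fromℕ (suc n))) (fromℕ-pos n))

    both : ∀ x y → fromℕ ((if x then 1 else 0) ℕ.* (if y then 1 else 0)) ≈ ⟦ x ∧ y ⟧
    both true  true  = +-identityʳ 1#
    both true  false = ≈-refl
    both false y     = ≈-refl

    counted≈ : ∀ ω → fromℕ (count (a , b) (buffer S t≤N ω) ℕ.* count (b , c) (buffer S t≤N ω))
                       ≈ ⟦ does (counted? Δ ω) ⟧
    counted≈ ω = ≈-trans
      (≈-reflexive (cong₂ (λ x y → fromℕ (x ℕ.* y))
        (count≡indicator (a , b) (buffer S t≤N ω) (Tracked.count≤1 (a , b) ab edge-ab t≤N ω))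
        (count≡indicator (b , c) (buffer S t≤N ω) (Tracked.count≤1 (b , c) bc edge-bc t≤N ω))))
      (both (does ((a , b) ∈? buffer S t≤N ω)) (does ((b , c) ∈? buffer S t≤N ω)))

-- Strictness is claimed for positive δ only: at δ = 0 no smoothing takes place, Y equals X, ε
-- equals σX², and the two lower bounds coincide.
lemma7 : ∀ {k ℓ₁ ℓ₂ v} (K : OrderedField k ℓ₁ ℓ₂) →
    let open OrderedField K
        open Probability K
    in
    {V : Set v} (_≟_ : DecidableEquality V)
    {N : ℕ} (S : GraphStream V N)
    (M : ℕ) → 2 ℕ.≤ M →
    (J : ℕ) .{{_ : NonZero J}}
    (δ : Carrier) → 0# ≤ δ → δ < 1# →
    (Δ : Triangle S) →
    let open FURL K _≟_ S M
        Tλ = Triangle.formationTime Δ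
    in
    M ℕ.+ 1 ℕ.< Tλ →
    (T : ℕ) (Tλ≤T : Tλ ℕ.≤ T) → T ℕ.≤ N →
    (2# - δ) / (1# - δ) < q Tλ →
    let Xλ  = X Δ Tλ≤T
        Yλ  = Y J δ Δ Tλ≤T
        μX  = 𝔼 Xλ
        σX² = Var Xλ
        μY  = 𝔼 Yλ
        σY² = Var Yλ
        ε   = (μX - μY) + σY²
    in
    (μX ≈ 1#)
    × (1# - 1# / σY² ≤ Pr (λ ω → ∣ Yλ ω - μX ∣ <? ε))
    × (1# - σX² / (ε ²) ≤ Pr (λ ω → ∣ Xλ ω - μX ∣ <? ε))
    × (1# - σX² / (ε ²) ≤ 1# - 1# / σY²)
    × (0# < δ → 1# - σX² / (ε ²) < 1# - 1# / σY²)
lemma7 K _≟_ S M 2≤M J δ 0≤δ δ<1 Δ M+1<Tλ T Tλ≤T _ hyp =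
  𝔼X≈1 , Y-bound , X-bound , bounds-≤ , λ 0<δ → bounds-< (c<1 0<δ)
  where
  open OrderedField K
  open Probability K
  open OrderedFieldProperties K renaming (refl to ≈-refl; sym to ≈-sym; trans to ≈-trans; reflexive to ≈-reflexive)
  open Expectation K
  open FURL K _≟_ S M
  open Triangle Δ using (ca) renaming (formationTime to Tλ)
  open Smoothing K _≟_ S M J
  open ≤-Reasoning

  1+M<Tλ : suc M ℕ.< Tλ
  1+M<Tλ = subst (ℕ._< Tλ) (ℕ.+-comm M 1) M+1<Tλ

  counted : Draws T → Bool
  counted ω = does (counted? Δ (prefix (ℕ.≤⇒≤′ (ℕ.<⇒≤ Tλ≤T)) ω))

  𝔼-counted*q≈1 : 𝔼 (λ ω → ⟦ counted ω ⟧) * q Tλ ≈ 1#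
  𝔼-counted*q≈1 = ≈-trans
    (*-congʳ (𝔼-prefix (ℕ.≤⇒≤′ (ℕ.<⇒≤ Tλ≤T)) (λ ω → ⟦ does (counted? Δ ω) ⟧)))
    (𝔼-counted K _≟_ S M 2≤M Δ (ℕ.<⇒≤ (ℕ.s<s⁻¹ 1+M<Tλ)))

  X≈ : ∀ ω → X Δ Tλ≤T ω ≈ q Tλ * ⟦ counted ω ⟧
  X≈ ω with counted ω
  ... | true  = ≈-trans
    (≈-reflexive (cong (if_then 1# else q Tλ) (dec-false (Tλ ℕ.≤? suc M) (ℕ.<⇒≱ 1+M<Tλ))))
    (≈-sym (*-identityʳ _))
  ... | false = ≈-sym (zeroʳ _)

  formed : ℕ → Carrier
  formed t = ⟦ does (Tλ ℕ.≤? t) ⟧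

  formed≤1 : ∀ t → formed t ≤ 1#
  formed≤1 t with does (Tλ ℕ.≤? t)
  ... | true  = inj₂ ≈-refl
  ... | false = 0≤1

  c : Carrier
  c = smooth J δ formed (bucket J δ T) T

  Y≈ : ∀ ω → Y J δ Δ Tλ≤T ω ≈ c * (q Tλ * ⟦ counted ω ⟧)
  Y≈ ω = smooth-* δ scaled (bucket J δ T) T
    where
    scaled : ∀ t → (if does (Tλ ℕ.≤? t) then X Δ Tλ≤T ω else 0#) ≈ formed t * (q Tλ * ⟦ counted ω ⟧)
    scaled t with does (Tλ ℕ.≤? t)
    ... | true  = ≈-trans (X≈ ω) (≈-sym (*-identityˡ _))
    ... | false = ≈-sym (zeroˡ _)

  i : ℕ
  i = (T ℕ.∸ suc (suc M)) ℕ./ J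

  -- As T ≥ Tλ > M + 1, bucket 0 is over by time `T`. The lower bound and the strict upper bound for
  -- `c` both unfold the recursion at this positive bucket.
  bucket≡1+i : bucket J δ T ≡ suc i
  bucket≡1+i = bucket-positive δ (ℕ.<-≤-trans 1+M<Tλ Tλ≤T)

  c≈ : c ≈ smooth J δ formed (suc i) T
  c≈ = ≈-reflexive (cong (λ j → smooth J δ formed j T) bucket≡1+i)

  0≤formed : ∀ t → 0# ≤ formed t
  0≤formed t = 0≤⟦b⟧ (does (Tλ ℕ.≤? t))

  1-δ≤c : 1# - δ ≤ c
  1-δ≤c = begin
    1# - δ                         ≤⟨ smooth-≥1-δ δ 0≤δ δ<1 0≤formed formed≤1 i {T}
                                        (≈-reflexive (cong ⟦_⟧ (dec-true (Tλ ℕ.≤? T) Tλ≤T))) ⟩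
    smooth J δ formed (suc i) T    ≈⟨ c≈ ⟨
    c                              ∎

  c≤1 : c ≤ 1#
  c≤1 = smooth-≤1 δ 0≤δ δ<1 0≤formed formed≤1 (bucket J δ T) T

  c<1 : 0# < δ → c < 1#
  c<1 0<δ = begin-strict
    c                              ≈⟨ c≈ ⟩
    -- The triangle forms after the end of bucket 0, so the profile is 0 there.
    smooth J δ formed (suc i) T    <⟨ smooth-<1 δ 0≤δ δ<1 0≤formed formed≤1 0<δ
                                        (≈-reflexive (cong ⟦_⟧ (dec-false (Tλ ℕ.≤? suc M) (ℕ.<⇒≱ 1+M<Tλ)))) i T ⟩
    1#                             ∎

  open TwoPoint K
  open Comparison counted (q Tλ) 𝔼-counted*q≈1 δ<1 1-δ≤c c≤1 hyp X≈ Y≈
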